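{- Let $\mathfrak T=(n_1,\dots,n_t)$ be a tower type of degree $n$ satisfying one of: (1) $n<8$; (2) $n=8$ and $\mathfrak T\neq(8)$; (3) $n$ is prime; (4) $\mathfrak T=(p,\dots,p)$ for a prime $p$; (5) $\mathfrak T=(2,p)$ for a prime $p$; (6) $\mathfrak T=(3,p)$ for a prime $p$. Then $T(\mathfrak T)$ is the unique minimal element, with respect to the pointwise partial order, of the set of flag types $T_{\mathcal F}$ where $\mathcal F$ ranges over flags (of finite abelian groups or finite field extensions) of tower type $\mathfrak T$.
   Context: Let $[n]=\{0,\dots,n-1\}$. A flag of a finite abelian group $G$ of order $n$ (written multiplicatively) is a chain of subsets $\{1\}=F_0\subset\cdots\subset F_{n-1}=G$ with $|F_i|=i+1$; a flag of a degree $n$ field extension $L/K$ is a chain of $K$-subspaces $K=F_0\subset\cdots\subset F_{n-1}=L$ with $\dim_KF_i=i+1$. The flag type of a flag is $T_{\mathcal F}:[n]\times[n]\to[n]$, $T_{\mathcal F}(i,j)=\min\{k: F_iF_j\subseteq F_k\}$, where $F_iF_j$ is the set of products (groups) or the $K$-span of products (fields). Partial order: $T\le T'$ iff $T(i,j)\le T'(i,j)$ for all $i,j$. The tower type of a flag of $G$: the distinct subgroups generated by the sets $F_i$, $i\in[n]$, form a chain $\{1\}=G_0\subset G_1\subset\cdots\subset G_t=G$, and the tower type is $(|G_1|/|G_0|,\dots,|G_t|/|G_{t-1}|)$; for a flag of $L/K$, the distinct subfields $K(F_i)$ generated over $K$ by the $F_i$ form a chain $K=L_0\subset\cdots\subset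 L_t=L$ and the tower type is $([L_1:L_0],\dots,[L_t:L_{t-1}])$. A tower type of degree $n$ is a tuple $(n_1,\dots,n_t)$ of integers $>1$ with product $n$. Writing $i\in[n]$ in mixed radix notation $i=i_1+i_2n_1+\cdots+i_tn_1\cdots n_{t-1}$ ($0\le i_s<n_s$), let $H=C_{n_1}\times\cdots\times C_{n_t}$, $e_s$ a generator of the $s$-th factor, $v_i=e_1^{i_1}\cdots e_t^{i_t}$, $F_i=\{v_0,\dots,v_i\}$; $T(\mathfrak T)$ is the flag type of this flag of $H$. -}

module Defs where

open import Level using (Level; _⊔_; 0ℓ) renaming (suc to lsuc)
open import Data.Nat using (ℕ; zero; suc; _≤_; _<_; _%_; _/_) renaming (_⊔_ to _⊔ₙ_; _+_ to _+ₙ_; _*_ to _*ₙ_)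
open import Data.Nat.Primality using (Prime)
open import Data.Fin using (Fin; toℕ)
open import Data.List using (List; []; _∷_; map)
open import Data.Nat.ListAction using (product)
open import Data.List.Relation.Unary.All using (All)
open import Data.List.Membership.Propositional using (_∈_)
open import Data.Product using (Σ; ∃; _×_; _,_)
open import Data.Sum using (_⊎_)
open import Relation.Nullary using (¬_)
open import Relation.Binary.PropositionalEquality using (_≡_; _≢_)
open import Algebra.Bundles using (AbelianGroup; CommutativeRing)
open import Algebra.Morphism.Structures using (module RingMorphisms)
import Data.Vec.Functional as VF

IsTowerType : List ℕ → Set
IsTowerType 𝔗 = All (λ m → 2 ≤ m) 𝔗

prefixProds : List ℕ → List ℕ
prefixProds []       = 1 ∷ []
prefixProds (m ∷ ms) = 1 ∷ map (m *ₙ_) (prefixProds ms)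

Condition : List ℕ → Set
Condition 𝔗 =
  (product 𝔗 < 8)
  ⊎ ((product 𝔗 ≡ 8) × (𝔗 ≢ 8 ∷ []))
  ⊎ Prime (product 𝔗)
  ⊎ (∃ λ p → Prime p × All (λ m → m ≡ p) 𝔗)
  ⊎ (∃ λ p → Prime p × (𝔗 ≡ 2 ∷ p ∷ []))
  ⊎ (∃ λ p → Prime p × (𝔗 ≡ 3 ∷ p ∷ []))

-- The flag type T(𝔗) of the standard flag of H = C_{n₁} × ⋯ × C_{n_t}.
-- Identify v_i with its index i (mixed radix).  Then v_a v_b = v_{a ⊕ b}
-- where ⊕ is digitwise addition modulo the radices, and
-- T(𝔗)(i,j) = min{k : {v_a v_b : a ≤ i, b ≤ j} ⊆ {v_0,…,v_k}}
--           = max{a ⊕ b : a ≤ i, b ≤ j}.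

radixAdd : List ℕ → ℕ → ℕ → ℕ
radixAdd []             a b = 0
radixAdd (zero ∷ ms)    a b = 0   -- never used (radices are ≥ 2)
radixAdd (suc m ∷ ms)   a b =
  ((a % suc m +ₙ b % suc m) % suc m) +ₙ suc m *ₙ radixAdd ms (a / suc m) (b / suc m)

maxUpTo : ℕ → (ℕ → ℕ) → ℕ
maxUpTo zero    f = f 0
maxUpTo (suc i) f = maxUpTo i f ⊔ₙ f (suc i)

T𝔗 : List ℕ → ℕ → ℕ → ℕ
T𝔗 𝔗 i j = maxUpTo i (λ a → maxUpTo j (λ b → radixAdd 𝔗 a b))

-- Flags of finite abelian groups.
-- A flag {1} = F₀ ⊂ ⋯ ⊂ F_{n-1} = G with |F_i| = i+1 is the same as an
-- enumeration v : Fin n ≅ G with v₀ = 1, via F_i = {v_0,…,v_i}.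

module _ {a ℓ : Level} (G : AbelianGroup a ℓ) where
  open AbelianGroup G

  record GroupFlag (n : ℕ) : Set (a ⊔ ℓ) where
    field
      v      : Fin n → Carrier
      v-one  : ∀ i → toℕ i ≡ 0 → v i ≈ ε
      v-inj  : ∀ i j → v i ≈ v j → i ≡ j
      v-surj : ∀ g → ∃ λ i → g ≈ v i

  module _ {n : ℕ} (F : GroupFlag n) where
    open GroupFlag F

    InGF : Fin n → Carrier → Set ℓ
    InGF i x = ∃ λ b → (toℕ b ≤ toℕ i) × (x ≈ v b)

    GProdSub : Fin n → Fin n → Fin n → Set (a ⊔ ℓ)
    GProdSub i j k = ∀ x y → InGF i x → InGF j y → InGF k (x ∙ y)

    GIsFlagType : (Fin n → Fin n → Fin n) → Set (a ⊔ ℓ)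
    GIsFlagType T = ∀ i j → GProdSub i j (T i j)
                           × (∀ k → GProdSub i j k → toℕ (T i j) ≤ toℕ k)

    data GGen (i : Fin n) : Carrier → Set (a ⊔ ℓ) where
      gen  : ∀ {x} → InGF i x → GGen i x
      one  : GGen i ε
      mul  : ∀ {x y} → GGen i x → GGen i y → GGen i (x ∙ y)
      inv  : ∀ {x} → GGen i x → GGen i (x ⁻¹)
      resp : ∀ {x y} → x ≈ y → GGen i x → GGen i y

  HasSize : ∀ {p} → (Carrier → Set p) → ℕ → Set (a ⊔ ℓ ⊔ p)
  HasSize P d = ∃ λ (w : Fin d → Carrier) →
      (∀ s → P (w s))
    × (∀ s t → w s ≈ w t → s ≡ t)
    × (∀ x → P x → ∃ λ s → x ≈ w s)

  GHasTowerType : {n : ℕ} → GroupFlag n → List ℕ → Set (a ⊔ ℓ)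
  GHasTowerType F 𝔗 =
      (∀ i → ∃ λ d → HasSize (GGen F i) d × d ∈ prefixProds 𝔗)
    × (∀ d → d ∈ prefixProds 𝔗 → ∃ λ i → HasSize (GGen F i) d)

record Field (c ℓ : Level) : Set (lsuc (c ⊔ ℓ)) where
  field
    commutativeRing : CommutativeRing c ℓ
  open CommutativeRing commutativeRing public
  field
    0≉1     : ¬ (0# ≈ 1#)
    inverse : ∀ x → ¬ (x ≈ 0#) → ∃ λ y → x * y ≈ 1#

-- Flags of finite field extensions L/K (K ↪ L via a ring homomorphism ι).
-- A flag K = F₀ ⊂ ⋯ ⊂ F_{n-1} = L with dim F_i = i+1 is given by a K-basis
-- v₀ = 1, v₁, …, v_{n-1} of L with F_i = span_K(v_0,…,v_i).

module _ {k kℓ l lℓ : Level} (K : Field k kℓ) (L : Field l lℓ)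
         (ι : Field.Carrier K → Field.Carrier L) where
  private
    module K = Field K
    module L = Field L
  open L using (Carrier; _≈_; _+_; _*_; -_; 0#; 1#)

  IsFieldEmbedding : Set (k ⊔ kℓ ⊔ lℓ)
  IsFieldEmbedding =
    RingMorphisms.IsRingHomomorphism (CommutativeRing.rawRing K.commutativeRing)
                                     (CommutativeRing.rawRing L.commutativeRing) ι

  lincomb : ∀ {d} → (Fin d → K.Carrier) → (Fin d → Carrier) → Carrier
  lincomb c w = VF.foldr _+_ 0# (λ s → ι (c s) * w s)

  LinIndep : ∀ {d} → (Fin d → Carrier) → Set (k ⊔ kℓ ⊔ lℓ)
  LinIndep w = ∀ c → lincomb c w ≈ 0# → ∀ s → c s K.≈ K.0#

  record FieldFlag (n : ℕ) : Set (k ⊔ kℓ ⊔ l ⊔ lℓ) where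
    field
      v        : Fin n → Carrier
      v-one    : ∀ i → toℕ i ≡ 0 → v i ≈ 1#
      v-indep  : LinIndep v
      v-span   : ∀ x → ∃ λ c → x ≈ lincomb c v

  module _ {n : ℕ} (F : FieldFlag n) where
    open FieldFlag F

    InFF : Fin n → Carrier → Set (k ⊔ kℓ ⊔ lℓ)
    InFF i x = ∃ λ c → (∀ b → toℕ i < toℕ b → c b K.≈ K.0#) × (x ≈ lincomb c v)

    -- F_i F_j ⊆ F_k  (F_k is a subspace, so this says span(F_i F_j) ⊆ F_k)
    FProdSub : Fin n → Fin n → Fin n → Set (k ⊔ kℓ ⊔ l ⊔ lℓ)
    FProdSub i j m = ∀ x y → InFF i x → InFF j y → InFF m (x * y)

    FIsFlagType : (Fin n → Fin n → Fin n) → Set (k ⊔ kℓ ⊔ l ⊔ lℓ)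
    FIsFlagType T = ∀ i j → FProdSub i j (T i j)
                           × (∀ m → FProdSub i j m → toℕ (T i j) ≤ toℕ m)

    data FGen (i : Fin n) : Carrier → Set (k ⊔ kℓ ⊔ l ⊔ lℓ) where
      gen   : ∀ {x} → InFF i x → FGen i x
      scal  : ∀ c → FGen i (ι c)
      add   : ∀ {x y} → FGen i x → FGen i y → FGen i (x + y)
      neg   : ∀ {x} → FGen i x → FGen i (- x)
      mul   : ∀ {x y} → FGen i x → FGen i y → FGen i (x * y)
      inv   : ∀ {x y} → FGen i x → x * y ≈ 1# → FGen i y
      resp  : ∀ {x y} → x ≈ y → FGen i x → FGen i y

  HasDim : ∀ {p} → (Carrier → Set p) → ℕ → Set (k ⊔ kℓ ⊔ l ⊔ lℓ ⊔ p)
  HasDim P d = ∃ λ (w : Fin d → Carrier) →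
      (∀ s → P (w s))
    × LinIndep w
    × (∀ x → P x → ∃ λ c → x ≈ lincomb c w)

  FHasTowerType : {n : ℕ} → FieldFlag n → List ℕ → Set (k ⊔ kℓ ⊔ l ⊔ lℓ)
  FHasTowerType F 𝔗 =
      (∀ i → ∃ λ d → HasDim (FGen F i) d × d ∈ prefixProds 𝔗)
    × (∀ d → d ∈ prefixProds 𝔗 → ∃ λ i → HasDim (FGen F i) d)

{-# OPTIONS --safe #-}
-- The lower bounds come from Kneser's theorem, proved at once for abelian groups
-- and for field extensions with the cells of Balandraud and Bachoc–Serra–Zémor.
-- Fix C = F_k; a cell is a pair (X, X*) with X = (C : X*), X* = (C : X), and
-- φ(X) = dim X + dim X* is supermodular on cells.  By downward induction on ν, a
-- cell of minimal dimension among those with φ ≥ ν is, up to translation, a subfield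
-- (subgroup) H over which every cell with φ ≥ ν is a module.  If F_i F_j ⊆ F_k, the
-- cell of F_i thus consists of H-modules X ⊇ F_i and X* ⊇ F_j with
-- dim X + dim X* ≤ dim H + k + 1.  When h = dim H is a prefix product of 𝔗 this
-- gives T(𝔗)(i,j) ≤ k, because h ∣ x, h ∣ y, a < x, b < y force a ⊕ b < x + y − h in
-- mixed radix.  For every other divisor h of the degrees at hand, an H-module of
-- dimension h containing F_i would be H itself, so it would contain the subfield
-- generated by F_i, whose degree is a prefix product and, apart from a few small i,
-- does not divide h; hence both modules have dimension at least 2h, and k is large.
module Submission where

open import Defs
open import Level using (Level; 0ℓ; _⊔_; Lift; lift; lower) renaming (suc to lsuc)
open import Data.Nat using (ℕ; zero; suc; _+_; _*_; _∸_; _/_; _%_; _⊓_; _≤_; _<_; NonZero; >-nonZero; z≤n; s≤s; s≤s⁻¹; _≤?_; _<?_; _≟_)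
import Data.Nat.Properties as ℕₚ
open import Data.Nat.Coprimality using (Coprime; coprime-divisor)
open import Data.Nat.DivMod using (m%n<n; m%n≤m; m≡m%n+[m/n]*n; m<n*o⇒m/o<n; m%n%n≡m%n; %-distribˡ-+; [m+kn]%n≡m%n; m<n⇒m%n≡m; m<n⇒m/n≡0; m*n/n≡m; +-distrib-/-∣ʳ; n%n≡0; 0/n≡0)
open import Data.Nat.Divisibility using (_∣_; divides; _∣?_; _∣0; 1∣_; ∣m∣n⇒∣m+n; ∣-refl; ∣-trans; ∣⇒≤; *-cancelˡ-∣; 0∣⇒≡0; ∣1⇒≡1)
open import Data.Nat.Induction using (<-rec)
open import Data.Nat.ListAction using (product)
open import Data.Nat.Primality using (Prime; prime?; prime[2]; prime⇒irreducible; prime⇒nonZero)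
open import Data.Nat.Tactic.RingSolver using (solve-∀)
open import Data.Fin using (Fin; toℕ; fromℕ<; inject≤) renaming (zero to fzero; suc to fsuc)
import Data.Fin.Properties as Finₚ
open import Data.List using (List; []; _∷_)
open import Data.List.Membership.DecPropositional _≟_ using (_∈?_)
open import Data.List.Membership.Propositional using (_∈_; find; lose)
open import Data.List.Membership.Propositional.Properties using (∈-map⁺; ∈-map⁻)
open import Data.List.Relation.Unary.All using (All; []; _∷_)
open import Data.List.Relation.Unary.Any using (Any; here; there; any?)
import Data.Vec.Functional as VF
open import Data.Empty using (⊥)
open import Data.Unit.Polymorphic using (⊤; tt)
open import Data.Product using (Σ; ∃; ∃₂; _×_; _,_; proj₁; proj₂)
open import Data.Sum using (_⊎_; inj₁; inj₂)
open import Function using (_∘_; id)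
open import Relation.Nullary using (¬_; Dec; yes; no; contradiction; True; toWitness; from-yes; from-no; _→-dec_; _×-dec_)
open import Relation.Nullary.Decidable using (decidable-stable; ¬¬-excluded-middle)
open import Relation.Binary.PropositionalEquality using (_≡_; _≢_; refl; sym; trans; cong; cong₂; subst; subst₂; isEquivalence; module ≡-Reasoning)
open import Algebra.Bundles using (CommutativeMonoid; AbelianGroup)
open import Algebra.Morphism.Structures using (module RingMorphisms)
import Algebra.Properties.Ring

-- Besides the lower bound, a flag attaining it is required: the standard flag of H is shown to have
-- tower type 𝔗 and flag type T(𝔗), which makes T(𝔗) the least element. L/K may be inseparable and
-- have infinitely many intermediate fields, so nothing can rest on choosing among finitely many of
-- them. Cells of minimal dimension always exist, and the field obtained from one serves all cells
-- of its level at once. The conditions on 𝔗 come from the divisors h of n that are not prefix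
-- products. If both modules have dimension at least 2h, Kneser's bound gives only 3h ≤ k + 1, which
-- is conclusive when 3h ≥ n, for then k = n - 1. For (q, p) with q ≠ p the exceptional divisor is
-- p, whence q ≤ 3; (4) and (6) have 3h ≥ n for h = 2 and h = 3. For (8) the divisor 2 gives only 6
-- < 8. The type (4, 2) has the same divisor 2 but is rescued by its prefix product 4.

_>>=_ : ∀ {a b} {A : Set a} {B : Set b} → ¬ ¬ A → (A → ¬ ¬ B) → ¬ ¬ B
(m >>= f) k = m λ x → f x k

return : ∀ {a} {A : Set a} → A → ¬ ¬ A
return x k = k x

-- Group elements or field elements, with the subsets or the K-subspaces.  Neither
-- K nor L has decidable equality, so subspaces are ¬¬-stable, and bases, witnesses
-- and case distinctions are only available under ¬¬; this suffices because the
-- theorem ends in a decidable inequality.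
record SubspaceFamily (c ℓ q s : Level) : Set (lsuc (c ⊔ ℓ ⊔ q ⊔ s)) where
  field
    commutativeMonoid : CommutativeMonoid c ℓ
  open CommutativeMonoid commutativeMonoid public renaming (refl to ≈-refl; sym to ≈-sym; trans to ≈-trans)

  Pred : Set (lsuc (c ⊔ q))
  Pred = Carrier → Set (c ⊔ q)

  field
    IsSub   : Pred → Set s
    stable  : ∀ {P : Pred} → IsSub P → ∀ {x} → ¬ ¬ P x → P x
    resp-≈  : ∀ {P : Pred} → IsSub P → ∀ {x y} → x ≈ y → P x → P y
    ∩-isSub : ∀ {P Q} → IsSub P → IsSub Q → IsSub (λ x → P x × Q x)
    ∶-isSub : ∀ {C} (X : Pred) → IsSub C → IsSub (λ y → ∀ x → X x → C (x ∙ y))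
    shift-isSub : ∀ {P} u → IsSub P → IsSub (λ x → P (u ∙ x))

  Sub : Set (lsuc (c ⊔ q) ⊔ s)
  Sub = Σ Pred IsSub

  isSub : (P : Sub) → IsSub (proj₁ P)
  isSub = proj₂

  infix 4 _∋_ _⊆_ _≐_
  infixl 6 _∩_
  _∋_ : Sub → Carrier → Set (c ⊔ q)
  _∋_ = proj₁

  _⊆_ _≐_ : Sub → Sub → Set (c ⊔ q)
  P ⊆ Q = ∀ {x} → P ∋ x → Q ∋ x
  P ≐ Q = (P ⊆ Q) × (Q ⊆ P)

  _∩_ : Sub → Sub → Sub
  P ∩ Q = _ , ∩-isSub (isSub P) (isSub Q)

  _∶_ : Sub → Sub → Sub
  C ∶ X = _ , ∶-isSub (proj₁ X) (isSub C)

  -- A preimage, that is u⁻¹P, so that it makes sense before u is known to be invertible. The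
  -- translate zP is therefore written `shift z′ P` with z′ an inverse of z.
  shift : Carrier → Sub → Sub
  shift u P = _ , shift-isSub u (isSub P)

-- What the subsets of a group and the K-subspaces of L have in common: a modular lattice with an
-- atom through every point outside 𝟎. There 𝟎 is the empty set or the zero space, so "not in 𝟎" is
-- no restriction in a group and means nonzero in a field.
record Geometry (c ℓ q s : Level) : Set (lsuc (c ⊔ ℓ ⊔ q ⊔ s)) where
  infixl 6 _∨_
  field
    subspaces  : SubspaceFamily c ℓ q s
  open SubspaceFamily subspaces public
  field
    𝟎 𝟏        : Sub
    𝟎-least    : ∀ P → 𝟎 ⊆ P
    𝟏-greatest : ∀ {x} → 𝟏 ∋ x
    _∨_        : Sub → Sub → Sub
    ∨-left     : ∀ P Q → P ⊆ P ∨ Q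
    ∨-right    : ∀ P Q → Q ⊆ P ∨ Q
    ∨-least    : ∀ P Q R → P ⊆ R → Q ⊆ R → P ∨ Q ⊆ R
    modular    : ∀ P Q R → Q ⊆ R → R ∩ (P ∨ Q) ⊆ (R ∩ P) ∨ Q
    ⟨_⟩        : Carrier → Sub
    ⟨⟩-self    : ∀ x → ⟨ x ⟩ ∋ x
    ⟨⟩-least   : ∀ P x → P ∋ x → ⟨ x ⟩ ⊆ P
    ⟨⟩-atom    : ∀ {x y} → ⟨ x ⟩ ∋ y → ¬ 𝟎 ∋ y → ⟨ y ⟩ ∋ x
    ε∉𝟎        : ¬ 𝟎 ∋ ε
    invertible : ∀ {x} → ¬ 𝟎 ∋ x → ∃ λ y → x ∙ y ≈ ε

-- Dimension theory

module Dimension {c ℓ q s} (G : Geometry c ℓ q s) where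
  open Geometry G

  infixl 6 _⊕_
  _⊕_ : Sub → Carrier → Sub
  P ⊕ x = P ∨ ⟨ x ⟩

  ⊕-least : ∀ P x R → P ⊆ R → R ∋ x → P ⊕ x ⊆ R
  ⊕-least P x R P⊆R x∈R = ∨-least P ⟨ x ⟩ R P⊆R (⟨⟩-least R x x∈R)

  ⊕-self : ∀ P x → P ⊕ x ∋ x
  ⊕-self P x = ∨-right P ⟨ x ⟩ (⟨⟩-self x)

  ⊕-left : ∀ P x → P ⊆ P ⊕ x
  ⊕-left P x = ∨-left P ⟨ x ⟩

  ⊕-mono : ∀ {P Q} x → P ⊆ Q → P ⊕ x ⊆ Q ⊕ x
  ⊕-mono {P} {Q} x P⊆Q = ⊕-least P x (Q ⊕ x) (λ h → ⊕-left Q x (P⊆Q h)) (⊕-self Q x)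

  ⊕-swap : ∀ P x y → P ⊕ x ⊕ y ⊆ P ⊕ y ⊕ x
  ⊕-swap P x y = ⊕-least (P ⊕ x) y (P ⊕ y ⊕ x)
    (⊕-mono x (⊕-left P y)) (⊕-left (P ⊕ y) x (⊕-self P y))

  -- Steinitz exchange from modularity: if x were outside R = P ⊕ y, then R would meet the atom ⟨ x
  -- ⟩ only in 𝟎, and the modular law would place y, which lies in R and in ⟨ x ⟩ ∨ P, inside P.
  exchange : ∀ P x y → P ⊕ x ∋ y → ¬ P ∋ y → P ⊕ y ∋ x
  exchange P x y y∈ y∉P = stable (isSub R) λ x∉R → y∉P
    (∨-least (R ∩ ⟨ x ⟩) P P
      (λ (z∈R , z∈x) → 𝟎-least P (stable (isSub 𝟎) λ z∉𝟎 →
        x∉R (⟨⟩-least R _ z∈R (⟨⟩-atom z∈x z∉𝟎))))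
      id
      (modular ⟨ x ⟩ P R (⊕-left P y) (⊕-self P y , ∨-least P ⟨ x ⟩ (⟨ x ⟩ ∨ P) (∨-right ⟨ x ⟩ P) (∨-left ⟨ x ⟩ P) y∈)))
    where R = P ⊕ y

  ⊆-⊎-∃ : ∀ P Q → ¬ ¬ ((Q ⊆ P) ⊎ ∃ λ x → Q ∋ x × ¬ P ∋ x)
  ⊆-⊎-∃ P Q k = k (inj₁ λ x∈Q → stable (isSub P) λ x∉P → k (inj₂ (_ , x∈Q , x∉P)))

  -- A chain of length d of one-point extensions from P up to Q.
  Ext : Sub → ℕ → Sub → Set (c ⊔ q)
  Ext P zero    Q = ∀ x → Q ∋ x → P ∋ x
  Ext P (suc d) Q = ∃ λ x → Q ∋ x × ¬ P ∋ x × Ext (P ⊕ x) d Q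

  Ext-cong : ∀ d {P P′ Q Q′} → P ≐ P′ → Q ≐ Q′ → Ext P d Q → Ext P′ d Q′
  Ext-cong zero    (P⊆ , _) (_ , Q′⊆) Q⊆P x h = P⊆ (Q⊆P x (Q′⊆ h))
  Ext-cong (suc d) (P⊆ , P′⊆) Q≐ (x , x∈Q , x∉P , e) =
    x , proj₁ Q≐ x∈Q , (λ h → x∉P (P′⊆ h)) , Ext-cong d (⊕-mono x P⊆ , ⊕-mono x P′⊆) Q≐ e

  -- By exchange, any point of Q outside P can be moved to the front of a chain without changing its
  -- length. Uniqueness of the length and the splitting of chains both rest on this.
  Ext-through : ∀ d {P Q} y → Q ∋ y → ¬ P ∋ y → Ext P d Q →
                ¬ ¬ (∃ λ d′ → d ≡ suc d′ × Ext (P ⊕ y) d′ Q)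
  Ext-through zero    y y∈Q y∉P Q⊆P = contradiction (Q⊆P y y∈Q) y∉P
  Ext-through (suc d) {P} {Q} y y∈Q y∉P (x , x∈Q , x∉P , e) = ¬¬-excluded-middle >>= λ where
    (yes y∈) → return (d , refl , Ext-cong d
      ( ⊕-least P x (P ⊕ y) (⊕-left P y) (exchange P x y y∈ y∉P)
      , ⊕-least P y (P ⊕ x) (⊕-left P x) y∈) (id , id) e)
    (no y∉) → Ext-through d y y∈Q y∉ e >>= λ where
      (d′ , refl , e′) → return (d , refl , x , x∈Q , (λ h → y∉ (exchange P y x h x∉P)) ,
        Ext-cong d′ (⊕-swap P x y , ⊕-swap P y x) (id , id) e′)

  Ext-split : ∀ n {P Q R} → P ⊆ Q → Q ⊆ R → Ext P n R →
              ¬ ¬ (∃₂ λ d m → Ext P d Q × Ext Q m R)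
  Ext-split zero    P⊆Q Q⊆R e = return (0 , 0 , (λ x h → e x (Q⊆R h)) , λ x h → P⊆Q (e x h))
  Ext-split (suc n) {P} {Q} {R} P⊆Q Q⊆R e = ⊆-⊎-∃ P Q >>= λ where
    (inj₁ Q⊆P) → return (0 , suc n , (λ _ → Q⊆P) , Ext-cong (suc n) (P⊆Q , Q⊆P) (id , id) e)
    (inj₂ (x , x∈Q , x∉P)) → Ext-through (suc n) x (Q⊆R x∈Q) x∉P e >>= λ where
      (_ , refl , e′) → Ext-split n (⊕-least P x Q P⊆Q x∈Q) Q⊆R e′ >>= λ
        (d , m , e₁ , e₂) → return (suc d , m , (x , x∈Q , x∉P , e₁) , e₂)

  Ext-trans : ∀ d {m P Q R} → P ⊆ Q → Q ⊆ R → Ext P d Q → Ext Q m R → Ext P (d + m) R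
  Ext-trans zero {m} P⊆Q Q⊆R Q⊆P e = Ext-cong m (Q⊆P _ , P⊆Q) (id , id) e
  Ext-trans (suc d) {P = P} {Q} P⊆Q Q⊆R (x , x∈Q , x∉P , e₁) e =
    x , Q⊆R x∈Q , x∉P , Ext-trans d (⊕-least P x Q P⊆Q x∈Q) Q⊆R e₁ e

  Ext-unique : ∀ d {m P Q} → Ext P d Q → Ext P m Q → d ≡ m
  Ext-unique zero    {zero}  e e′ = refl
  Ext-unique zero    {suc m} e (x , x∈Q , x∉P , _) = contradiction (e x x∈Q) x∉P
  Ext-unique (suc d) {m} (x , x∈Q , x∉P , e) e′ = decidable-stable (suc d ≟ m)
    (Ext-through m x x∈Q x∉P e′ >>= λ where
      (_ , refl , e″) → return (cong suc (Ext-unique d e e″)))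

  -- The same points serve for both chains, because modularity gives (P ∩ Q) ⊕ x = P ∩ (Q ⊕ x) for x
  -- in P.
  Ext-iso : ∀ d {P Q} → Ext (P ∩ Q) d P → Ext Q d (P ∨ Q)
  Ext-iso zero    {P} {Q} e x = ∨-least P Q Q (λ h → proj₂ (e _ h)) id
  Ext-iso (suc d) {P} {Q} (x , x∈P , x∉PQ , e) =
    x , ∨-left P Q x∈P , (λ x∈Q → x∉PQ (x∈P , x∈Q)) ,
    Ext-cong d (id , id)
      ( ∨-least P (Q ⊕ x) (P ∨ Q) (∨-left P Q) (⊕-least Q x (P ∨ Q) (∨-right P Q) (∨-left P Q x∈P))
      , ∨-least P Q (P ∨ (Q ⊕ x)) (∨-left P (Q ⊕ x)) (λ h → ∨-right P (Q ⊕ x) (⊕-left Q x h)))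
      (Ext-iso d (Ext-cong d (to , from) (id , id) e))
    where
    to : (P ∩ Q) ⊕ x ⊆ P ∩ (Q ⊕ x)
    to = ⊕-least (P ∩ Q) x (P ∩ (Q ⊕ x)) (λ (h , h′) → h , ⊕-left Q x h′) (x∈P , ⊕-self Q x)
    from : P ∩ (Q ⊕ x) ⊆ (P ∩ Q) ⊕ x
    from = modular Q ⟨ x ⟩ P (⟨⟩-least P x x∈P)

  Dim : Sub → ℕ → Set (c ⊔ q)
  Dim P d = Ext 𝟎 d P

  Dim-cong : ∀ {d P Q} → P ≐ Q → Dim P d → Dim Q d
  Dim-cong {d} = Ext-cong d (id , id)

  Dim-⊕ : ∀ {d P x} → ¬ P ∋ x → Dim P d → Dim (P ⊕ x) (suc d)
  Dim-⊕ {d} {P} {x} x∉P D = subst (Dim (P ⊕ x)) (ℕₚ.+-comm d 1)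
    (Ext-trans d (𝟎-least P) (⊕-left P x) D (x , ⊕-self P x , x∉P , λ _ → id))

  module Inverse {u u′} (uu′ : u ∙ u′ ≈ ε) where
    cancel : ∀ x → u ∙ (u′ ∙ x) ≈ x
    cancel x = ≈-trans (≈-sym (assoc u u′ x)) (≈-trans (∙-congʳ uu′) (identityˡ x))

    cancel′ : ∀ x → u′ ∙ (u ∙ x) ≈ x
    cancel′ x = ≈-trans (≈-sym (assoc u′ u x)) (≈-trans (∙-congʳ (≈-trans (comm u′ u) uu′)) (identityˡ x))

    Ext-shift : ∀ d {P Q} → Ext P d Q → Ext (shift u P) d (shift u Q)
    Ext-shift zero    e y = e _
    Ext-shift (suc d) {P} {Q} (x , x∈Q , x∉P , e) =
      u′ ∙ x , resp-≈ (isSub Q) (≈-sym (cancel x)) x∈Q , (λ h → x∉P (resp-≈ (isSub P) (cancel x) h)) ,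
      Ext-cong d
        ( (λ {y} h → resp-≈ (isSub S) (cancel′ y)
            (⊕-least P x (shift u′ S)
              (λ {z} h → ⊕-left (shift u P) (u′ ∙ x) (resp-≈ (isSub P) (≈-sym (cancel z)) h))
              (⊕-self (shift u P) (u′ ∙ x)) h))
        , ⊕-least (shift u P) (u′ ∙ x) (shift u (P ⊕ x)) (⊕-left P x)
            (resp-≈ (isSub (P ⊕ x)) (≈-sym (cancel x)) (⊕-self P x)))
        (id , id) (Ext-shift d e)
      where S = shift u P ⊕ (u′ ∙ x)

    Dim-shift : ∀ {d P} → Dim P d → Dim (shift u P) d
    Dim-shift {d} {P} D = Ext-cong d
      ((λ {y} h → resp-≈ (isSub 𝟎) (cancel′ y) (𝟎-least (shift u′ 𝟎) h)) , 𝟎-least (shift u 𝟎)) (id , id) (Ext-shift d D)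

  open Inverse public using (Dim-shift)

  module Finite {n : ℕ} (D𝟏 : Dim 𝟏 n) where

    dim : ∀ P → ¬ ¬ ∃ (Dim P)
    dim P = Ext-split n (𝟎-least P) (λ _ → 𝟏-greatest) D𝟏 >>= λ (d , _ , e , _) → return (d , e)

    codim : ∀ {P Q} → P ⊆ Q → ¬ ¬ ∃ λ d → Ext P d Q
    codim {P} {Q} P⊆Q = Ext-split n (𝟎-least P) (λ _ → 𝟏-greatest) D𝟏 >>= λ (_ , m , _ , e) →
      Ext-split m P⊆Q (λ _ → 𝟏-greatest) e >>= λ (d , _ , e′ , _) → return (d , e′)

    dim-mono : ∀ {P Q d e} → P ⊆ Q → Dim P d → Dim Q e → d ≤ e
    dim-mono {P} {d = d} {e} P⊆Q D E = decidable-stable (d ≤? e) (codim P⊆Q >>= λ (m , F) →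
      return (subst (d ≤_) (Ext-unique (d + m) (Ext-trans d (𝟎-least P) P⊆Q D F) E) (ℕₚ.m≤m+n d m)))

    dim-reflects-⊇ : ∀ {P Q d e} → P ⊆ Q → Dim P d → Dim Q e → e ≤ d → Q ⊆ P
    dim-reflects-⊇ {P} {Q} {d} {e} P⊆Q D E e≤d {x} x∈Q = stable (isSub P) (codim P⊆Q >>= λ where
      (zero  , F) → return (F x x∈Q)
      (suc m , F) → contradiction
        (subst (_≤ d) (sym (Ext-unique (d + suc m) (Ext-trans d (𝟎-least P) P⊆Q D F) E)) e≤d) (ℕₚ.m+1+n≰m d))

    dim-strict : ∀ {P Q d e x} → P ⊆ Q → Q ∋ x → ¬ P ∋ x → Dim P d → Dim Q e → d < e
    dim-strict P⊆Q x∈Q x∉P D E = ℕₚ.≰⇒> λ e≤d → x∉P (dim-reflects-⊇ P⊆Q D E e≤d x∈Q)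

    dim-unique : ∀ {P d e} → Dim P d → Dim P e → d ≡ e
    dim-unique {d = d} = Ext-unique d

    -- R is any common upper bound because it will be a side of a cell, which may be larger than P ∨
    -- Q.
    dim-modular : ∀ {P Q R a b c r} → P ⊆ R → Q ⊆ R →
                  Dim P a → Dim Q b → Dim (P ∩ Q) c → Dim R r → a + b ≤ c + r
    dim-modular {P} {Q} {R} {a} {b} {c} {r} P⊆R Q⊆R Da Db Dc Dr = decidable-stable (_ ≤? _)
      (codim {P ∩ Q} {P} proj₁ >>= λ (d , E) → dim (P ∨ Q) >>= λ (m , Dm) → return (begin
        a + b         ≡⟨ cong (_+ b) (dim-unique Da (Ext-trans c (𝟎-least (P ∩ Q)) proj₁ Dc E)) ⟩
        c + d + b     ≡⟨ ℕₚ.+-assoc c d b ⟩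
        c + (d + b)   ≡⟨ cong (c +_) (ℕₚ.+-comm d b) ⟩
        c + (b + d)   ≡⟨ cong (c +_) (dim-unique (Ext-trans b (𝟎-least Q) (∨-right P Q) Db (Ext-iso d E)) Dm) ⟩
        c + m         ≤⟨ ℕₚ.+-monoʳ-≤ c (dim-mono (∨-least P Q R P⊆R Q⊆R) Dm Dr) ⟩
        c + r         ∎))
      where open ℕₚ.≤-Reasoning

    dim-disjoint : ∀ {P Q R a b r} → P ⊆ R → Q ⊆ R → P ∩ Q ⊆ 𝟎 →
                   Dim P a → Dim Q b → Dim R r → a + b ≤ r
    dim-disjoint P⊆R Q⊆R PQ⊆𝟎 Da Db Dr = dim-modular P⊆R Q⊆R Da Db (λ _ → PQ⊆𝟎) Dr

    IsModule : Sub → Sub → Set (c ⊔ q)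
    IsModule H P = ∀ {x h} → P ∋ x → H ∋ h → P ∋ x ∙ h

    record IsSubfield (H : Sub) : Set (c ⊔ q) where
      field
        unit   : H ∋ ε
        closed : IsModule H H

      -- Multiplication by x embeds H in itself; by equality of finite dimensions it is onto, so it
      -- reaches ε.
      inverse-closed : ∀ {x y} → H ∋ x → x ∙ y ≈ ε → H ∋ y
      inverse-closed {x} {y} x∈H xy = stable (isSub H) (dim H >>= λ (d , D) →
        return (dim-reflects-⊇ {H} {shift x H} (closed x∈H) D (Dim-shift xy D) ℕₚ.≤-refl (resp-≈ (isSub H) (≈-sym xy) unit)))

    module _ {H : Sub} (isSubfield : IsSubfield H) where
      open IsSubfield isSubfield

      -- If x = zk lies in P with k in H and x outside 𝟎, then z = x k⁻¹ lies in the module P; here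
      -- k⁻¹ is z x⁻¹.
      translate-disjoint : ∀ {P z z′} → IsModule H P → z ∙ z′ ≈ ε → ¬ P ∋ z → shift z′ H ∩ P ⊆ 𝟎
      translate-disjoint {P} {z} {z′} mod zz′ z∉P {x} (x∈zH , x∈P) = stable (isSub 𝟎) λ x∉𝟎 →
        let (x′ , xx′) = invertible x∉𝟎
            z≈ : x ∙ (z ∙ x′) ≈ z
            z≈ = ≈-trans (≈-sym (assoc x z x′)) (≈-trans (∙-congʳ (comm x z))
                   (≈-trans (assoc z x x′) (≈-trans (∙-congˡ xx′) (identityʳ z))))
            inv : (z′ ∙ x) ∙ (z ∙ x′) ≈ ε
            inv = ≈-trans (assoc z′ x (z ∙ x′)) (≈-trans (∙-congˡ z≈) (≈-trans (comm z′ z) zz′))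
        in z∉P (resp-≈ (isSub P) z≈ (mod x∈P (inverse-closed x∈zH inv)))

      -- Coset counting: for x in P outside Z, the coset xH is disjoint from the module Z, so xH ∨ Z
      -- is a module exactly h dimensions above Z, and the rest of the chain is shorter.
      lagrange-Ext : ∀ {h} → Dim H h → ∀ m {Z P} → IsModule H Z → IsModule H P → Z ⊆ P → Ext Z m P → h ∣ m
      lagrange-Ext {h} D = <-rec _ λ where
        zero    rec _    _    _   _ → h ∣0
        (suc m) rec {Z} {P} modZ modP Z⊆P E@(x , x∈P , x∉Z , _) → decidable-stable (h ∣? suc m)
          let (x′ , xx′) = invertible {x} (λ h → x∉Z (𝟎-least Z h))
              x′x = ≈-trans (comm x′ x) xx′
              xH = shift x′ H
              Z′ = xH ∨ Z
              xH⊆P : xH ⊆ P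
              xH⊆P {y} y∈ = resp-≈ (isSub P) (Inverse.cancel xx′ y) (modP x∈P y∈)
              Z′⊆P : Z′ ⊆ P
              Z′⊆P = ∨-least xH Z P xH⊆P Z⊆P
              modZ′ : IsModule H Z′
              modZ′ {y} {k} y∈ k∈ = resp-≈ (isSub Z′) (comm k y) (∨-least xH Z (shift k Z′)
                (λ {w} w∈ → ∨-left xH Z (resp-≈ (isSub H)
                  (≈-trans (assoc x′ w k) (∙-congˡ (comm w k))) (closed w∈ k∈)))
                (λ {w} w∈ → ∨-right xH Z (resp-≈ (isSub Z) (comm w k) (modZ w∈ k∈))) y∈)
              E₁ : Ext Z h Z′
              E₁ = Ext-iso h (Ext-cong h (𝟎-least (xH ∩ Z) , translate-disjoint {Z} modZ xx′ x∉Z) (id , id) (Dim-shift x′x D))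
          in codim {Z′} {P} Z′⊆P >>= λ (m′ , E₂) →
             let eq : suc m ≡ h + m′
                 eq = Ext-unique (suc m) E (Ext-trans h (∨-right xH Z) Z′⊆P E₁ E₂)
                 h>0 : 0 < h
                 h>0 = dim-strict {𝟎} {H} (𝟎-least H) unit ε∉𝟎 (λ _ → id) D
             in return (subst (h ∣_) (sym eq) (∣m∣n⇒∣m+n ∣-refl
                  (rec (subst (m′ <_) (sym eq) (ℕₚ.m<n+m m′ h>0)) modZ′ modP Z′⊆P E₂)))

      lagrange : ∀ {h m P} → Dim H h → IsModule H P → Dim P m → h ∣ m
      lagrange {m = m} {P} D mod E = lagrange-Ext D m
        (λ {x} {h} x∈𝟎 _ → resp-≈ (isSub 𝟎) (comm h x) (𝟎-least (shift h 𝟎) x∈𝟎)) mod (𝟎-least P) E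

-- Kneser's theorem

module Kneser {c ℓ q s} (G : Geometry c ℓ q s) {n : ℕ} (D𝟏 : Dimension.Dim G (Geometry.𝟏 G) n) (C : Geometry.Sub G) where
  open Geometry G
  open Dimension G
  open Finite D𝟏

  record Cell : Set (lsuc (c ⊔ q) ⊔ s) where
    field
      l r   : Sub
      l⊥r   : ∀ {x y} → l ∋ x → r ∋ y → C ∋ x ∙ y
      l-max : ∀ {x} → (∀ y → r ∋ y → C ∋ x ∙ y) → l ∋ x
      r-max : ∀ {y} → (∀ x → l ∋ x → C ∋ x ∙ y) → r ∋ y
  open Cell

  C-comm : ∀ {x y} → C ∋ x ∙ y → C ∋ y ∙ x
  C-comm = resp-≈ (isSub C) (comm _ _)

  swap : Cell → Cell
  swap A = record
    { l = r A ; r = l A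
    ; l⊥r = λ x∈ y∈ → C-comm (l⊥r A y∈ x∈)
    ; l-max = λ f → r-max A λ x x∈ → C-comm (f x x∈)
    ; r-max = λ f → l-max A λ x x∈ → C-comm (f x x∈)
    }

  meet join : Cell → Cell → Cell
  meet A B = record
    { l = l A ∩ l B ; r = C ∶ (l A ∩ l B)
    ; l⊥r = λ x∈ f → f _ x∈
    ; l-max = λ f → l-max A (λ y y∈ → f y (λ x x∈ → l⊥r A (proj₁ x∈) y∈))
                  , l-max B (λ y y∈ → f y (λ x x∈ → l⊥r B (proj₂ x∈) y∈))
    ; r-max = id
    }
  join A B = swap (meet (swap A) (swap B))

  translate : ∀ {u u′} → u ∙ u′ ≈ ε → Cell → Cell
  translate {u} {u′} uu′ A = record
    { l = shift u′ (l A) ; r = shift u (r A)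
    ; l⊥r = λ {x} {y} x∈ y∈ → resp-≈ (isSub C) (eq x y) (l⊥r A x∈ y∈)
    ; l-max = λ {x} f → l-max A λ y y∈ → resp-≈ (isSub C) (move x y)
        (f (u′ ∙ y) (resp-≈ (isSub (r A)) (≈-sym (cancel y)) y∈))
    ; r-max = λ {y} f → r-max A λ x x∈ → resp-≈ (isSub C) (≈-trans (∙-congʳ (comm u x)) (assoc x u y))
        (f (u ∙ x) (resp-≈ (isSub (l A)) (≈-sym (cancel′ x)) x∈))
    }
    where
    open Inverse uu′
    move : ∀ x y → x ∙ (u′ ∙ y) ≈ (u′ ∙ x) ∙ y
    move x y = ≈-trans (≈-sym (assoc x u′ y)) (∙-congʳ (comm x u′))
    eq : ∀ x y → (u′ ∙ x) ∙ (u ∙ y) ≈ x ∙ y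
    eq x y = ≈-trans (≈-sym (move x (u ∙ y))) (∙-congˡ (cancel′ y))

  full : Cell
  full = record
    { l = 𝟏 ; r = C ∶ 𝟏 ; l⊥r = λ {x} _ f → f x 𝟏-greatest ; l-max = λ _ → 𝟏-greatest ; r-max = id }

  l-⊆⇒r-⊇ : ∀ A B → l A ⊆ l B → r B ⊆ r A
  l-⊆⇒r-⊇ A B l⊆ y∈ = r-max A λ x x∈ → l⊥r B (l⊆ x∈) y∈

  separate : ∀ A {x} → ¬ l A ∋ x → ¬ ¬ ∃ λ z → r A ∋ z × ¬ C ∋ x ∙ z
  separate A x∉ k = x∉ (l-max A λ z z∈ → stable (isSub C) λ xz∉ → k (z , z∈ , xz∉))

  r-IsModule : ∀ A {H} → IsModule H (l A) → IsModule H (r A)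
  r-IsModule A mod {y} {h} y∈ h∈ = r-max A λ x x∈ → resp-≈ (isSub C)
    (≈-trans (assoc x h y) (∙-congˡ (comm h y))) (l⊥r A (mod x∈ h∈) y∈)

  -- φ(A) ≥ ν, in a negative form which is stable.
  AtLeast : ℕ → Cell → Set (c ⊔ q)
  AtLeast ν A = ∀ {a b} → Dim (l A) a → Dim (r A) b → ν ≤ a + b

  atLeast : ∀ {ν} A {a b} → Dim (l A) a → Dim (r A) b → ν ≤ a + b → AtLeast ν A
  atLeast A Da Db ν≤ Da′ Db′ rewrite dim-unique Da′ Da | dim-unique Db′ Db = ν≤

  -- Supermodularity of φ: the left sides of A and B lie in that of the join and the right sides in
  -- that of the meet, so `dim-modular` applies on each side and φ(A) + φ(B) ≤ φ(meet) + φ(join). A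
  -- meet below level ν thus raises the join.
  module _ {A B} {ν a a* b b* e j z w}
           (Da : Dim (l A) a) (Da* : Dim (r A) a*) (Db : Dim (l B) b) (Db* : Dim (r B) b*)
           (De : Dim (l (meet A B)) e) (Dj : Dim (r (meet A B)) j)
           (Dz : Dim (l (join A B)) z) (Dw : Dim (r (join A B)) w)
           (small : e + j < ν) where

    private
      le : a + b ≤ e + z
      le = dim-modular {l A} {l B} {l (join A B)}
             (λ x∈ → λ y y∈ → C-comm (l⊥r A x∈ (proj₁ y∈))) (λ x∈ → λ y y∈ → C-comm (l⊥r B x∈ (proj₂ y∈))) Da Db De Dz

      re : a* + b* ≤ w + j
      re = dim-modular {r A} {r B} {r (meet A B)}
             (λ y∈ → λ x x∈ → l⊥r A (proj₁ x∈) y∈) (λ y∈ → λ x x∈ → l⊥r B (proj₂ x∈) y∈) Da* Db* Dw Dj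

    join-large : a + a* + (b + b*) < z + w + ν
    join-large = begin-strict
      a + a* + (b + b*)     ≡⟨ r₁ a a* b b* ⟩
      a + b + (a* + b*)     ≤⟨ ℕₚ.+-mono-≤ le re ⟩
      e + z + (w + j)       ≡⟨ r₂ e z w j ⟩
      z + w + (e + j)       <⟨ ℕₚ.+-monoʳ-< (z + w) small ⟩
      z + w + ν             ∎
      where
      open ℕₚ.≤-Reasoning
      r₁ : ∀ a b c d → a + b + (c + d) ≡ a + c + (b + d)
      r₁ = solve-∀
      r₂ : ∀ e z w j → e + z + (w + j) ≡ z + w + (e + j)
      r₂ = solve-∀

    join-grows : ν ≤ a + a* → b + b* < z + w
    join-grows ν≤ = ℕₚ.+-cancelʳ-< ν _ _ (ℕₚ.≤-<-trans
      (ℕₚ.≤-trans (ℕₚ.+-monoʳ-≤ (b + b*) ν≤) (ℕₚ.≤-reflexive (ℕₚ.+-comm (b + b*) (a + a*)))) join-large)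

    -- The inequality of the right sides alone: the right side of the join has codimension less than
    -- b = dim B in that of A. Disjoint cosets inside the right side of A are later played off
    -- against this.
    r-codim : ν ≤ b + b* → a* < b + w
    r-codim ν≤ = ℕₚ.+-cancelʳ-< b* _ _ (begin-strict
      a* + b*          ≤⟨ re ⟩
      w + j            ≤⟨ ℕₚ.+-monoʳ-≤ w (ℕₚ.m≤n+m j e) ⟩
      w + (e + j)      <⟨ ℕₚ.+-monoʳ-< w (ℕₚ.<-≤-trans small ν≤) ⟩
      w + (b + b*)     ≡⟨ r₃ w b b* ⟩
      b + w + b*       ∎)
      where
      open ℕₚ.≤-Reasoning
      r₃ : ∀ w b c → w + (b + c) ≡ b + w + c
      r₃ = solve-∀

  -- The second alternative of `large` covers a level that no nonzero cell reaches. Then 𝟏 serves as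
  -- the field, since a cell whose left side is zero is a module over anything.
  record Level-field (ν : ℕ) : Set (lsuc (c ⊔ q) ⊔ s) where
    field
      H          : Cell
      isSubfield : IsSubfield (l H)
      module-of  : ∀ A → AtLeast ν A → IsModule (l H) (l A)
      large      : AtLeast ν H ⊎ 𝟏 ⊆ l H
    open IsSubfield isSubfield public

  𝟎-absorbs : ∀ P {x y} → 𝟎 ∋ x → P ∋ x ∙ y
  𝟎-absorbs P {x} {y} x∈𝟎 = resp-≈ (isSub P) (comm y x) (𝟎-least (shift y P) x∈𝟎)

  Nonzero : Sub → Set (c ⊔ q)
  Nonzero P = ∃ λ x → P ∋ x × ¬ 𝟎 ∋ x

  full-level-field : ∀ {ν} → (∀ A → Nonzero (l A) → ¬ AtLeast ν A) → Level-field ν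
  full-level-field none = record
    { H = full ; isSubfield = record { unit = 𝟏-greatest ; closed = λ _ _ → 𝟏-greatest }
    ; module-of = λ A at {x} x∈ _ → stable (isSub (l A)) λ xh∉ →
        none A (x , x∈ , λ x∈𝟎 → xh∉ (𝟎-absorbs (l A) x∈𝟎)) at
    ; large = inj₂ (λ _ → 𝟏-greatest) }

  record Minimal (ν : ℕ) : Set (lsuc (c ⊔ q) ⊔ s) where
    field
      X       : Cell
      unit    : l X ∋ ε
      large   : AtLeast ν X
      d       : ℕ
      D       : Dim (l X) d
      minimal : ∀ Y → Nonzero (l Y) → AtLeast ν Y → ∀ {e} → Dim (l Y) e → d ≤ e

  translate-large : ∀ {ν} Y {y y′} (yy′ : y ∙ y′ ≈ ε) (y′y : y′ ∙ y ≈ ε) → AtLeast ν Y → AtLeast ν (translate y′y Y)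
  translate-large {ν} Y yy′ y′y at {a} {b} Da Db = decidable-stable (ν ≤? a + b)
    (dim (l Y) >>= λ (a′ , Da′) → dim (r Y) >>= λ (b′ , Db′) →
     return (atLeast (translate y′y Y) (Dim-shift yy′ Da′) (Dim-shift y′y Db′) (at Da′ Db′) Da Db))

  minimise : ∀ {ν} d Y → Nonzero (l Y) → AtLeast ν Y → Dim (l Y) d → ¬ ¬ Minimal ν
  minimise {ν} = <-rec (λ d → ∀ Y → Nonzero (l Y) → AtLeast ν Y → Dim (l Y) d → ¬ ¬ Minimal ν)
    λ d rec Y (y , y∈ , y∉𝟎) at D → ¬¬-excluded-middle {A = Smaller d} >>= λ where
      (yes (Y′ , nz , at′ , e , E , e<d)) → rec e<d Y′ nz at′ E
      (no none) →
        let (y′ , yy′) = invertible y∉𝟎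
            y′y = ≈-trans (comm y′ y) yy′
        in return record
          -- Multiplying by y⁻¹ brings ε into the left side and preserves both dimensions, hence the
          -- level and the minimality.
          { X = translate y′y Y
          ; unit = resp-≈ (isSub (l Y)) (≈-sym (identityʳ y)) y∈
          ; large = translate-large Y yy′ y′y at
          ; d = d ; D = Dim-shift yy′ D
          ; minimal = λ Y′ nz at′ {e} E → ℕₚ.≮⇒≥ λ e<d → none (Y′ , nz , at′ , e , E , e<d) }
    where
    Smaller : ℕ → Set _
    Smaller d = ∃ λ Y → Nonzero (l Y) × AtLeast ν Y × ∃ λ e → Dim (l Y) e × e < d

  module Step {ν} (M : Minimal ν) (level : ∀ ν′ → ν < ν′ → ¬ ¬ Level-field ν′) where
    open Minimal M

    -- A nonzero cell smaller than X at level ν would contradict the minimality of X. This feeds the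
    -- hypothesis `small` of the supermodular inequalities.
    weak-meet : ∀ A B {e j} → Nonzero (l (meet A B)) → e < d →
                Dim (l (meet A B)) e → Dim (r (meet A B)) j → e + j < ν
    weak-meet A B nz e<d De Dj = ℕₚ.≰⇒> λ ν≤ →
      ℕₚ.<⇒≱ e<d (minimal (meet A B) nz (atLeast (meet A B) De Dj ν≤) De)

    -- Otherwise the join J of X and K is a K-module, and zK is disjoint from
    -- J.r inside K.r for some z, which makes the codimension of J.r too large.
    X⊆level-field : ∀ {ν′} (K : Level-field ν′) → ν < ν′ → l X ⊆ l (Level-field.H K)
    X⊆level-field {ν′} K ν<ν′ {y} y∈X = stable (isSub (l H)) λ y∉H → case y∉H (Level-field.large K)
      where
      open Level-field K using (H; isSubfield; module-of; closed) renaming (unit to unit′)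
      case : ¬ l H ∋ y → AtLeast ν′ H ⊎ 𝟏 ⊆ l H → ⊥
      case y∉H (inj₂ 𝟏⊆H) = y∉H (𝟏⊆H 𝟏-greatest)
      case y∉H (inj₁ at) =
        (dim (l H) >>= λ (h , Dh) → dim (r H) >>= λ (h* , Dh*) → dim (r X) >>= λ (d* , D*) →
         dim (l (meet H X)) >>= λ (e , De) → dim (r (meet H X)) >>= λ (j , Dj) →
         dim (l J) >>= λ (m , Dm) → dim (r J) >>= λ (w , Dw) → separate H y∉H >>= λ (z , z∈ , yz∉C) →
         let e<d = dim-strict {l (meet H X)} {l X} proj₂ y∈X (λ yy → y∉H (proj₁ yy)) De D
             small = weak-meet H X (ε , (unit′ , unit) , ε∉𝟎) e<d De Dj
             grows : h + h* < m + w
             grows = ℕₚ.+-cancelʳ-< ν (h + h*) (m + w) (ℕₚ.≤-<-trans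
                       (ℕₚ.+-monoʳ-≤ (h + h*) (large D D*))
                       (join-large {H} {X} Dh Dh* D D* De Dj Dm Dw small))
             J-module : IsModule (l H) (r J)
             J-module = r-IsModule J {l H} (module-of J (atLeast J Dm Dw
               (ℕₚ.≤-trans (at Dh Dh*) (ℕₚ.<⇒≤ grows))))
             z∉J : ¬ r J ∋ z
             z∉J zz = yz∉C (l⊥r X y∈X (proj₂ zz))
             (z′ , zz′) = invertible {z} (λ z∈𝟎 → z∉J (𝟎-least (r J) z∈𝟎))
             zH⊆ : shift z′ (l H) ⊆ r H
             zH⊆ {u} u∈ = resp-≈ (isSub (r H)) (Inverse.cancel zz′ u) (r-IsModule H {l H} closed z∈ u∈)
             h+w≤h* : h + w ≤ h*
             h+w≤h* = dim-disjoint {shift z′ (l H)} {r J} {r H} zH⊆ proj₁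
                        (translate-disjoint isSubfield {r J} J-module zz′ z∉J)
                        (Dim-shift (≈-trans (comm z′ z) zz′) Dh) Dw Dh*
             d≤h : d ≤ h
             d≤h = minimal H (ε , unit′ , ε∉𝟎) (λ Da Db → ℕₚ.≤-trans (ℕₚ.<⇒≤ ν<ν′) (at Da Db)) Dh
             h*<d+w : h* < d + w
             h*<d+w = r-codim {H} {X} Dh Dh* D D* De Dj Dm Dw small (large D D*)
         in return (ℕₚ.<-irrefl refl (ℕₚ.<-≤-trans h*<d+w (ℕₚ.≤-trans (ℕₚ.+-monoˡ-≤ w d≤h) h+w≤h*)))) id
        where J = join H X

    -- A cell A with φ(A) ≥ ν is an X-module: otherwise x y z ∉ C for some x ∈ A,
    -- y ∈ X, z ∈ A*.  Let Z be the join of A and x X, let V be the join of A* and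
    -- z X, and let K be the field at level min (φ(Z), φ(V)) > ν.  Then A ∩ x K is
    -- disjoint from V*, hence smaller than X, so that the join of A and x K, which
    -- is Z, has φ(Z) > φ(K).  Likewise φ(V) > φ(K), which is absurd.
    module Translate (A : Cell) (A-large : AtLeast ν A) {x y z} (x∈ : l A ∋ x) (y∈ : l X ∋ y) (z∈ : r A ∋ z)
                     (xyz∉C : ¬ C ∋ (x ∙ y) ∙ z) where
      x∉𝟎 : ¬ 𝟎 ∋ x
      x∉𝟎 x∈𝟎 = xyz∉C (resp-≈ (isSub C) (≈-sym (assoc x y z)) (𝟎-absorbs C x∈𝟎))

      x′ = proj₁ (invertible x∉𝟎)
      xx′ : x ∙ x′ ≈ ε
      xx′ = proj₂ (invertible x∉𝟎)
      x′x : x′ ∙ x ≈ ε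
      x′x = ≈-trans (comm x′ x) xx′

      x∈xP : ∀ P → P ∋ ε → shift x′ P ∋ x
      x∈xP P ε∈P = resp-≈ (isSub P) (≈-sym x′x) ε∈P

      xX Z : Cell
      xX = translate xx′ X
      Z = join A xX

      module _ {a a* m w} (Da : Dim (l A) a) (Da* : Dim (r A) a*) (Dm : Dim (l Z) m) (Dw : Dim (r Z) w) where

        Z-large : ¬ ¬ (ν < m + w × a* < d + w)
        Z-large =
          dim (r X) >>= λ (d* , D*) → dim (l (meet A xX)) >>= λ (e , De) → dim (r (meet A xX)) >>= λ (j , Dj) →
          let xy∈ : shift x′ (l X) ∋ x ∙ y
              xy∈ = resp-≈ (isSub (l X)) (≈-sym (Inverse.cancel x′x y)) y∈
              DX = Dim-shift x′x D
              DX* = Dim-shift xx′ D*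
              e<d = dim-strict {l (meet A xX)} {l xX} proj₂ xy∈ (λ xy → xyz∉C (l⊥r A (proj₁ xy) z∈)) De DX
              small = weak-meet A xX (x , (x∈ , x∈xP (l X) unit) , x∉𝟎) e<d De Dj
          in return
            ( ℕₚ.≤-<-trans (large D D*) (join-grows {A} {xX} Da Da* DX DX* De Dj Dm Dw small (A-large Da Da*))
            , r-codim {A} {xX} Da Da* DX DX* De Dj Dm Dw small (large D D*))

        Z-larger : ∀ {ν′ v} (K : Level-field ν′) → l X ⊆ l (Level-field.H K) → AtLeast ν′ Z →
                   (V : Sub) → IsModule (l (Level-field.H K)) V → V ⊆ l A → ¬ V ∋ x →
                   Dim V v → a < d + v → ¬ ¬ (ν′ < m + w)
        Z-larger {ν′} {v} K X⊆K Z-at V V-module V⊆A x∉V Dv a<d+v =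
          dim (l H) >>= λ (h , Dh) → dim (r H) >>= λ (h* , Dh*) →
          dim (l (meet A xK)) >>= λ (e , De) → dim (r (meet A xK)) >>= λ (j , Dj) →
          let e+v≤a : e + v ≤ a
              e+v≤a = dim-disjoint {l (meet A xK)} {V} {l A} proj₁ V⊆A
                (λ u → translate-disjoint isSubfield {V} V-module xx′ x∉V (proj₂ (proj₁ u) , proj₂ u)) De Dv Da
              e<d : e < d
              e<d = ℕₚ.+-cancelʳ-< v e d (ℕₚ.≤-<-trans e+v≤a a<d+v)
              small = weak-meet A xK (x , (x∈ , x∈xP (l H) unit′) , x∉𝟎) e<d De Dj
          in case (Level-field.large K) e<d De λ at → return
               (ℕₚ.≤-<-trans (at Dh Dh*) (join-grows {A} {xK} Da Da* (Dim-shift x′x Dh) (Dim-shift xx′ Dh*) De Dj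
                 (Dim-cong (l-⊆⇒r-⊇ (swap W) (swap Z) W⊆Z , l-⊆⇒r-⊇ (swap Z) (swap W) Z⊆W) Dm)
                 (Dim-cong (Z⊆W , W⊆Z) Dw) small (A-large Da Da*)))
          where
          open Level-field K using (H; isSubfield; module-of) renaming (unit to unit′)
          xK W : Cell
          xK = translate xx′ H
          W = join A xK
          W⊆Z : r W ⊆ r Z
          W⊆Z (u∈A , u∈xK) = u∈A , l-⊆⇒r-⊇ X H X⊆K u∈xK
          Z⊆W : r Z ⊆ r W
          -- Z reaches the level of K, so its left side is a K-module; it contains x, hence all of
          -- xK, and the right side of Z therefore annihilates xK modulo C.
          Z⊆W {u} u∈ = proj₁ u∈ , r-max H λ k k∈ → resp-≈ (isSub C)
            (≈-trans (∙-congʳ (comm x k)) (assoc k x u))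
            (l⊥r Z (module-of Z Z-at {x} (λ t t∈ → C-comm (l⊥r A x∈ (proj₁ t∈))) k∈) u∈)
          case : ∀ {e} → AtLeast ν′ H ⊎ 𝟏 ⊆ l H → e < d → Dim (l (meet A xK)) e →
                 (AtLeast ν′ H → ¬ ¬ (ν′ < m + w)) → ¬ ¬ (ν′ < m + w)
          case (inj₁ at) _ _ f = f at
          -- If K were everything, A ∩ xK would be A, whose dimension is at least d by minimality of
          -- X.
          case (inj₂ 𝟏⊆H) e<d De _ _ = ℕₚ.<⇒≱ e<d (ℕₚ.≤-trans
            (minimal A (x , x∈ , x∉𝟎) A-large Da)
            (dim-mono {l A} {l (meet A xK)} (λ u∈ → u∈ , 𝟏⊆H 𝟏-greatest) Da De))

    X-module : ∀ A → AtLeast ν A → IsModule (l X) (l A)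
    X-module A at {x} {y} x∈ y∈ = stable (isSub (l A)) λ xy∉ → (separate A xy∉ >>= λ (z , z∈ , xyz∉) →
      let zyx∉ : ¬ C ∋ (z ∙ y) ∙ x
          zyx∉ = λ u → xyz∉ (resp-≈ (isSub C) (≈-trans (comm (z ∙ y) x) (≈-trans (∙-congˡ (comm z y)) (≈-sym (assoc x y z)))) u)
          at* : AtLeast ν (swap A)
          at* = λ {a} {b} Da Db → ℕₚ.≤-trans (at Db Da) (ℕₚ.≤-reflexive (ℕₚ.+-comm b a))
          module T = Translate A at x∈ y∈ z∈ xyz∉
          module U = Translate (swap A) at* z∈ y∈ x∈ zyx∉
      in dim (l A) >>= λ (a , Da) → dim (r A) >>= λ (a* , Da*) →
         dim (l T.Z) >>= λ (m , Dm) → dim (r T.Z) >>= λ (w , Dw) →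
         dim (l U.Z) >>= λ (m′ , Dm′) → dim (r U.Z) >>= λ (w′ , Dw′) →
         T.Z-large Da Da* Dm Dw >>= λ (ν<Z , a*<) → U.Z-large Da* Da Dm′ Dw′ >>= λ (ν<V , a<) →
         let ν′ = (m + w) ⊓ (m′ + w′)
             ν<ν′ : ν < ν′
             ν<ν′ = ℕₚ.⊓-glb ν<Z ν<V
             Z-at : AtLeast ν′ T.Z
             Z-at = atLeast T.Z Dm Dw (ℕₚ.m⊓n≤m (m + w) (m′ + w′))
             V-at : AtLeast ν′ U.Z
             V-at = atLeast U.Z Dm′ Dw′ (ℕₚ.m⊓n≤n (m + w) (m′ + w′))
         in level ν′ ν<ν′ >>= λ K →
         let X⊆K = X⊆level-field K ν<ν′
             mod = Level-field.module-of K
         in T.Z-larger Da Da* Dm Dw K X⊆K Z-at (r U.Z) (r-IsModule U.Z {l (Level-field.H K)} (mod U.Z V-at)) proj₁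
              (λ u → zyx∉ (C-comm-assoc (l⊥r X y∈ (proj₂ u)))) Dw′ a< >>= λ ν′<Z →
            U.Z-larger Da* Da Dm′ Dw′ K X⊆K V-at (r T.Z) (r-IsModule T.Z {l (Level-field.H K)} (mod T.Z Z-at)) proj₁
              (λ u → xyz∉ (C-comm-assoc (l⊥r X y∈ (proj₂ u)))) Dw a*< >>= λ ν′<V →
            return (ℕₚ.<-irrefl refl (ℕₚ.⊓-glb ν′<Z ν′<V))) id
      where
      C-comm-assoc : ∀ {y x z} → C ∋ y ∙ (x ∙ z) → C ∋ (x ∙ y) ∙ z
      C-comm-assoc {y} {x} {z} = resp-≈ (isSub C) (≈-trans (≈-sym (assoc y x z)) (∙-congʳ (comm y x)))

    level-field : Level-field ν
    level-field = record
      { H = X ; isSubfield = record { unit = unit ; closed = X-module X large }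
      ; module-of = X-module ; large = inj₁ large }

  -- The counter m turns downward induction on ν into structural recursion. At m = 0 the level
  -- exceeds 2n, which no cell reaches because each of its sides has dimension at most n.
  level-field : ∀ m ν → n + n < ν + m → ¬ ¬ Level-field ν
  level-field zero ν n< = return (full-level-field λ A _ at →
    (dim (l A) >>= λ (a , Da) → dim (r A) >>= λ (b , Db) →
     return (ℕₚ.<⇒≱ (subst (n + n <_) (ℕₚ.+-identityʳ ν) n<) (ℕₚ.≤-trans (at Da Db)
       (ℕₚ.+-mono-≤ (dim-mono (λ _ → 𝟏-greatest) Da D𝟏) (dim-mono (λ _ → 𝟏-greatest) Db D𝟏))))) id)
  level-field (suc m) ν n< = ¬¬-excluded-middle {A = ∃ λ A → Nonzero (l A) × AtLeast ν A} >>= λ where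
    (no none) → return (full-level-field λ A nz at → none (A , nz , at))
    (yes (A , nz , at)) → dim (l A) >>= λ (a , Da) → minimise a A nz at Da >>= λ M →
      return (Step.level-field M λ ν′ ν<ν′ → level-field m ν′
        (ℕₚ.<-≤-trans n< (ℕₚ.≤-trans (ℕₚ.≤-reflexive (ℕₚ.+-suc ν m)) (ℕₚ.+-monoˡ-≤ m ν<ν′))))

  record Stabiliser (P Q : Sub) (p : ℕ) : Set (lsuc (c ⊔ q) ⊔ s) where
    field
      {H X Y}    : Sub
      {h x y}    : ℕ
      isSubfield : IsSubfield H
      X-module   : IsModule H X
      Y-module   : IsModule H Y
      P⊆X        : P ⊆ X
      Q⊆Y        : Q ⊆ Y
      dim-H      : Dim H h
      dim-X      : Dim X x
      dim-Y      : Dim Y y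
      bound      : x + y ≤ h + p

  -- The level is taken to be φ of the cell A generated by Q, so the level field H satisfies x + y ≤
  -- φ(H). As ε lies in H, the right side of H is contained in C, and φ(H) ≤ h + p.
  kneser : ∀ {P Q p} → Dim C p → P ∋ ε → (∀ {x y} → P ∋ x → Q ∋ y → C ∋ x ∙ y) → ¬ ¬ Stabiliser P Q p
  kneser {P} {Q} {p} Dp ε∈P PQ⊆C =
    dim (l A) >>= λ (x , Dx) → dim (r A) >>= λ (y , Dy) →
    level-field (suc (n + n)) (x + y) (ℕₚ.m≤n+m (suc (n + n)) (x + y)) >>= stabiliser Dx Dy
    where
    A : Cell
    A = record
      { l = C ∶ Q ; r = C ∶ (C ∶ Q)
      ; l⊥r = λ x∈ y∈ → y∈ _ x∈
      ; l-max = λ f b b∈ → C-comm (f b (λ a a∈ → C-comm (a∈ b b∈)))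
      ; r-max = id }
    P⊆ : P ⊆ l A
    P⊆ a b b∈ = C-comm (PQ⊆C a b∈)
    bound : ∀ {ν x y h h*} (K : Level-field ν) → ν ≡ x + y → IsModule (l (Level-field.H K)) (l A) →
            AtLeast ν (Level-field.H K) ⊎ 𝟏 ⊆ l (Level-field.H K) →
            Dim (l (Level-field.H K)) h → Dim (r (Level-field.H K)) h* → Dim (l A) x → Dim (r A) y → x + y ≤ h + h*
    bound K refl _   (inj₁ at)  Dh Dh* Dx Dy = at Dh Dh*
    -- Here H is everything. Since A contains ε and is an H-module, its left side is everything too,
    -- so the right side of A lies in that of H.
    bound K _    mod (inj₂ 𝟏⊆H) Dh Dh* Dx Dy = ℕₚ.+-mono-≤ (dim-mono {l A} {l H} (λ _ → 𝟏⊆H 𝟏-greatest) Dx Dh)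
        (dim-mono {r A} {r H} (l-⊆⇒r-⊇ H A (λ {u} u∈ → resp-≈ (isSub (l A)) (identityˡ u) (mod {ε} (P⊆ ε∈P) u∈))) Dy Dh*)
      where open Level-field K
    stabiliser : ∀ {x y} → Dim (l A) x → Dim (r A) y → Level-field (x + y) → ¬ ¬ Stabiliser P Q p
    stabiliser Dx Dy K = dim (l H) >>= λ (h , Dh) → dim (r H) >>= λ (h* , Dh*) → return record
      { isSubfield = isSubfield ; X-module = mod ; Y-module = r-IsModule A {l H} mod
      ; P⊆X = P⊆ ; Q⊆Y = λ q f b → C-comm (b _ q) ; dim-H = Dh ; dim-X = Dx ; dim-Y = Dy
      ; bound = ℕₚ.≤-trans (bound K refl mod large Dh Dh* Dx Dy) (ℕₚ.+-monoʳ-≤ h (dim-mono {r H} {C} (λ {u} u∈ →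
          resp-≈ (isSub C) (identityˡ u) (l⊥r H unit u∈)) Dh* Dp)) }
      where
      open Level-field K
      mod : IsModule (l H) (l A)
      mod = module-of A (atLeast A Dx Dy ℕₚ.≤-refl)

-- The numerical content of F_i F_j ⊆ F_k: h is the degree of a stabilising
-- subfield H, x and y are the dimensions of H-modules containing F_i and F_j,
-- and gᵢ, gⱼ are the degrees of the subfields generated by F_i and F_j.
record Constraints (n i j k gᵢ gⱼ : ℕ) : Set where
  field
    {h x y} : ℕ
    h∣n     : h ∣ n
    h∣x     : h ∣ x
    h∣y     : h ∣ y
    i<x     : i < x
    j<y     : j < y
    i<gᵢ    : i < gᵢ
    j<gⱼ    : j < gⱼ
    bound   : x + y ≤ h + suc k
    gᵢ∣h    : x ≡ h → gᵢ ∣ h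
    gⱼ∣h    : y ≡ h → gⱼ ∣ h

-- From products of flag members to numerical constraints

module FlagConstraints {c ℓ q s} (G : Geometry c ℓ q s) where
  open Geometry G
  open Dimension G

  Span : ∀ d → (Fin d → Carrier) → Sub
  Span zero    w = 𝟎
  Span (suc d) w = Span d (w ∘ fsuc) ⊕ w fzero

  Indep : ∀ d → (Fin d → Carrier) → Set (c ⊔ q)
  Indep zero    w = ⊤
  Indep (suc d) w = ¬ Span d (w ∘ fsuc) ∋ w fzero × Indep d (w ∘ fsuc)

  Dim-Span : ∀ d {w} → Indep d w → Dim (Span d w) d
  Dim-Span zero    _         = λ _ → id
  Dim-Span (suc d) {w} (w∉ , ind) = Dim-⊕ {d} {Span d (w ∘ fsuc)} w∉ (Dim-Span d ind)

  Span-self : ∀ d {w} s → Span d w ∋ w s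
  Span-self (suc d) {w} fzero    = ⊕-self (Span d (w ∘ fsuc)) (w fzero)
  Span-self (suc d) {w} (fsuc s) = ⊕-left (Span d (w ∘ fsuc)) (w fzero) (Span-self d s)

  Span-least : ∀ d {w} S → (∀ s → S ∋ w s) → Span d w ⊆ S
  Span-least zero        S w∈ = 𝟎-least S
  Span-least (suc d) {w} S w∈ = ⊕-least (Span d (w ∘ fsuc)) (w fzero) S (Span-least d S (w∈ ∘ fsuc)) (w∈ fzero)

  module _ {n} (D𝟏 : Dim 𝟏 n) where
    open Finite D𝟏

    record Generated (P : Sub) (g : ℕ) : Set (lsuc (c ⊔ q) ⊔ s) where
      field
        {E}        : Sub
        isSubfield : IsSubfield E
        dim-E      : Dim E g
        P⊆E        : P ⊆ E
        least      : ∀ H → IsSubfield H → P ⊆ H → E ⊆ H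

      -- H contains E, so it is an E-module and Lagrange's theorem acts as the tower law.
      degree-∣ : ∀ {H h} → IsSubfield H → P ⊆ H → Dim H h → g ∣ h
      degree-∣ {H} H-sub P⊆H = lagrange isSubfield dim-E
        (λ x∈ e∈ → IsSubfield.closed H-sub x∈ (least H H-sub P⊆H e∈))

    -- Since ε lies in P and hence in the H-module X, H is contained in X; equal dimensions make X
    -- equal to H, so P generates a subfield of H.
    degree-∣-if-minimal : ∀ {H P X g h x} → IsSubfield H → Dim H h → Generated P g → P ∋ ε → P ⊆ X →
                          IsModule H X → Dim X x → x ≡ h → g ∣ h
    degree-∣-if-minimal {H} {P} {X} isSubfield Dh gen-P ε∈P P⊆X mod Dx refl = Generated.degree-∣ gen-P isSubfield
      (λ p∈ → dim-reflects-⊇ {H} {X} (λ {u} u∈ → resp-≈ (isSub X) (identityˡ u) (mod (P⊆X ε∈P) u∈))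
                Dh Dx ℕₚ.≤-refl (P⊆X p∈)) Dh

    constraints : ∀ {P Q C i j k gᵢ gⱼ} → Dim P (suc i) → Dim Q (suc j) → Dim C (suc k) → P ∋ ε → Q ∋ ε →
                  (∀ {x y} → P ∋ x → Q ∋ y → C ∋ x ∙ y) → Generated P gᵢ → Generated Q gⱼ →
                  ¬ ¬ Constraints n i j k gᵢ gⱼ
    constraints {P} {Q} {C} {k = k} DP DQ DC ε∈P ε∈Q PQ⊆C gen-P gen-Q =
      Kneser.kneser G D𝟏 C {P} {Q} DC ε∈P PQ⊆C >>= λ S → return (read-off S)
      where
      read-off : Kneser.Stabiliser G D𝟏 C P Q (suc k) → Constraints n _ _ k _ _
      read-off S = record
        { h∣n = lagrange isSubfield {P = 𝟏} dim-H (λ _ _ → 𝟏-greatest) D𝟏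
        ; h∣x = lagrange isSubfield {P = X} dim-H X-module dim-X
        ; h∣y = lagrange isSubfield {P = Y} dim-H Y-module dim-Y
        ; i<x = dim-mono {P} {X} P⊆X DP dim-X
        ; j<y = dim-mono {Q} {Y} Q⊆Y DQ dim-Y
        ; i<gᵢ = dim-mono {P} {Generated.E gen-P} (Generated.P⊆E gen-P) DP (Generated.dim-E gen-P)
        ; j<gⱼ = dim-mono {Q} {Generated.E gen-Q} (Generated.P⊆E gen-Q) DQ (Generated.dim-E gen-Q)
        ; bound = bound
        ; gᵢ∣h = degree-∣-if-minimal {H} {P} {X} isSubfield dim-H gen-P ε∈P P⊆X X-module dim-X
        ; gⱼ∣h = degree-∣-if-minimal {H} {Q} {Y} isSubfield dim-H gen-Q ε∈Q Q⊆Y Y-module dim-Y }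
        where open Kneser.Stabiliser S

-- Flags of abelian groups

module GroupGeometry {a ℓ} (G : AbelianGroup a ℓ) where
  open AbelianGroup G using (Carrier; _≈_; _∙_; ε; _⁻¹; commutativeMonoid; inverseʳ; ∙-congˡ) renaming (refl to ≈-refl; sym to ≈-sym; trans to ≈-trans)

  -- The subspaces are arbitrary subsets, with no algebraic closure: the join is union, atoms are
  -- singletons, dimension is cardinality, and modularity comes from distributivity. The double
  -- negations in unions and singletons make them stable.
  geometry : Geometry a ℓ ℓ (a ⊔ ℓ)
  geometry = record
    { subspaces = record
      { commutativeMonoid = commutativeMonoid
      ; IsSub  = λ P → (∀ {x} → ¬ ¬ P x → P x) × (∀ {x y} → x ≈ y → P x → P y)
      ; stable = λ S → proj₁ S
      ; resp-≈ = λ S → proj₂ S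
      ; ∩-isSub = λ (s , r) (s′ , r′) →
          (λ h → s (λ k → h (k ∘ proj₁)) , s′ (λ k → h (k ∘ proj₂))) , λ e (p , q) → r e p , r′ e q
      ; ∶-isSub = λ _ (s , r) →
          (λ h x x∈ → s λ k → h λ f → k (f x x∈)) , λ e f x x∈ → r (∙-congˡ e) (f x x∈)
      ; shift-isSub = λ u (s , r) → s , λ e → r (∙-congˡ e)
      }
    ; 𝟎 = (λ _ → Lift _ ⊥) , (λ h → lift (h lower)) , λ _ ()
    ; 𝟏 = (λ _ → ⊤) , (λ _ → tt) , λ _ _ → tt
    ; 𝟎-least = λ _ ()
    ; 𝟏-greatest = tt
    ; _∨_ = λ (P , _ , r) (Q , _ , r′) → (λ x → ¬ ¬ (P x ⊎ Q x)) , (λ h k → h λ h′ → h′ k) ,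
        λ e h k → h λ { (inj₁ p) → k (inj₁ (r e p)) ; (inj₂ q) → k (inj₂ (r′ e q)) }
    ; ∨-left = λ _ _ p k → k (inj₁ p)
    ; ∨-right = λ _ _ q k → k (inj₂ q)
    ; ∨-least = λ _ _ (_ , s , _) P⊆ Q⊆ h → s λ k → h λ { (inj₁ p) → k (P⊆ p) ; (inj₂ q) → k (Q⊆ q) }
    ; modular = λ _ _ _ _ (x∈R , h) k → h λ { (inj₁ p) → k (inj₁ (x∈R , p)) ; (inj₂ q) → k (inj₂ q) }
    ; ⟨_⟩ = λ x → (λ y → Lift a (¬ ¬ (x ≈ y))) , (λ h → lift λ k → h λ h′ → lower h′ k) ,
        λ e h → lift λ k → lower h λ e′ → k (≈-trans e′ e)
    ; ⟨⟩-self = λ _ → lift λ k → k ≈-refl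
    ; ⟨⟩-least = λ (_ , s , r) _ p h → s λ k → lower h λ e → k (r e p)
    ; ⟨⟩-atom = λ h _ → lift λ k → lower h λ e → k (≈-sym e)
    ; ε∉𝟎 = lower
    ; invertible = λ {x} _ → x ⁻¹ , inverseʳ x
    }

  open Geometry geometry using (Sub; _∋_; _⊆_; isSub; 𝟏)
  open Dimension geometry
  open FlagConstraints geometry

  Span⇒ : ∀ d {w x} → Span d w ∋ x → ¬ ¬ ∃ λ s → x ≈ w s
  Span⇒ zero    ()
  Span⇒ (suc d) {w} h = h >>= λ where
    (inj₁ p) → Span⇒ d p >>= λ (s , e) → return (fsuc s , e)
    (inj₂ e) → lower e >>= λ e′ → return (fzero , ≈-sym e′)

  Span⇐ : ∀ d {w x} s → x ≈ w s → Span d w ∋ x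
  Span⇐ d {w} s e = proj₂ (isSub (Span d w)) (≈-sym e) (Span-self d s)

  Indep-inj : ∀ d {w} → (∀ s t → w s ≈ w t → s ≡ t) → Indep d w
  Indep-inj zero    inj = tt
  Indep-inj (suc d) inj =
    (λ h → Span⇒ d h λ (s , e) → contradiction (inj fzero (fsuc s) e) λ ()) ,
    Indep-inj d λ s t e → Finₚ.suc-injective (inj (fsuc s) (fsuc t) e)

  HasSize⇒Dim : ∀ {p d} {P : Carrier → Set p} (S : Sub) → (∀ {x} → P x → S ∋ x) → (∀ {x} → S ∋ x → ¬ ¬ P x) →
                HasSize G P d → Dim S d
  HasSize⇒Dim {d = d} S P⇒S S⇒P (w , w∈ , inj , surj) = Dim-cong {d} {Span d w} {S}
    ( Span-least d S (λ s → P⇒S (w∈ s))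
    , λ h → proj₁ (isSub (Span d w)) (S⇒P h >>= λ p → let (s , e) = surj _ p in return (Span⇐ d s e)))
    (Dim-Span d (Indep-inj d inj))

  module _ {n} (F : GroupFlag G n) where
    open GroupFlag F

    initial : ∀ i → Fin (suc (toℕ i)) → Carrier
    initial i s = v (inject≤ s (Finₚ.toℕ<n i))

    flagSub : Fin n → Sub
    flagSub i = Span (suc (toℕ i)) (initial i)

    flagSub⇒ : ∀ i {x} → flagSub i ∋ x → ¬ ¬ InGF G F i x
    flagSub⇒ i h = Span⇒ _ {initial i} h >>= λ (s , e) → return
      (inject≤ s (Finₚ.toℕ<n i) , subst (_≤ toℕ i) (sym (Finₚ.toℕ-inject≤ s _)) (s≤s⁻¹ (Finₚ.toℕ<n s)) , e)

    flagSub⇐ : ∀ i {x} → InGF G F i x → flagSub i ∋ x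
    flagSub⇐ i {x} (b , b≤i , e) = Span⇐ _ {initial i} (fromℕ< (s≤s b≤i)) (subst (λ b → x ≈ v b)
      (Finₚ.toℕ-injective (sym (trans (Finₚ.toℕ-inject≤ _ _) (Finₚ.toℕ-fromℕ< _)))) e)

    Dim-flagSub : ∀ i → Dim (flagSub i) (suc (toℕ i))
    Dim-flagSub i = Dim-Span (suc (toℕ i)) {initial i} (Indep-inj (suc (toℕ i)) {initial i} λ s t e →
      Finₚ.inject≤-injective _ _ s t (v-inj _ _ e))

    Dim-𝟏 : Dim 𝟏 n
    Dim-𝟏 = HasSize⇒Dim {P = 𝟏 ∋_} 𝟏 id return
              (v , (λ _ → tt) , v-inj , λ x _ → v-surj x)

    ε∈flagSub : ∀ i → flagSub i ∋ ε
    ε∈flagSub i = proj₂ (isSub (flagSub i)) (v-one (inject≤ {suc (toℕ i)} fzero (Finₚ.toℕ<n i)) (Finₚ.toℕ-inject≤ {suc (toℕ i)} fzero _))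
      (Span-self (suc (toℕ i)) {initial i} fzero)

    open Finite Dim-𝟏

    generated : ∀ i {d} → HasSize G (GGen G F i) d → Generated Dim-𝟏 (flagSub i) d
    generated i size = record
      { E = E
      ; isSubfield = record { unit = return one ; closed = λ x∈ y∈ → x∈ >>= λ x → y∈ >>= λ y → return (mul x y) }
      ; dim-E = HasSize⇒Dim E return id size
      ; P⊆E = λ x∈ → flagSub⇒ i x∈ >>= λ x → return (gen x)
      ; least = λ H H-sub P⊆H x∈ → proj₁ (isSub H) (x∈ >>= λ x → return (least H H-sub P⊆H x)) }
      where
      E : Sub
      E = (λ x → ¬ ¬ GGen G F i x) , (λ h k → h λ h′ → h′ k) , λ e h k → h λ g → k (resp e g)
      least : ∀ H → IsSubfield H → flagSub i ⊆ H → ∀ {x} → GGen G F i x → H ∋ x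
      least H H-sub P⊆H (gen x∈)  = P⊆H (flagSub⇐ i x∈)
      least H H-sub P⊆H one       = IsSubfield.unit H-sub
      least H H-sub P⊆H (mul x y) = IsSubfield.closed H-sub (least H H-sub P⊆H x) (least H H-sub P⊆H y)
      least H H-sub P⊆H (inv x)   = IsSubfield.inverse-closed H-sub (least H H-sub P⊆H x) (inverseʳ _)
      least H H-sub P⊆H (resp e x) = proj₂ (isSub H) e (least H H-sub P⊆H x)

    group-constraints : ∀ {i j k gᵢ gⱼ} → GProdSub G F i j k → HasSize G (GGen G F i) gᵢ → HasSize G (GGen G F j) gⱼ →
                        ¬ ¬ Constraints n (toℕ i) (toℕ j) (toℕ k) gᵢ gⱼ
    group-constraints {i} {j} {k} ij⊆k sᵢ sⱼ =
      constraints Dim-𝟏 {flagSub i} {flagSub j} {flagSub k} (Dim-flagSub i) (Dim-flagSub j) (Dim-flagSub k) (ε∈flagSub i) (ε∈flagSub j)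
        (λ x∈ y∈ → proj₁ (isSub (flagSub k)) (flagSub⇒ i x∈ >>= λ x → flagSub⇒ j y∈ >>= λ y →
          return (flagSub⇐ k (ij⊆k _ _ x y)))) (generated i sᵢ) (generated j sⱼ)

-- Flags of field extensions

module FieldGeometry {k kℓ l lℓ} (K : Field k kℓ) (L : Field l lℓ) (ι : Field.Carrier K → Field.Carrier L)
                     (ι-embedding : IsFieldEmbedding K L ι) where
  private module K = Field K
  open Field L using (Carrier; _≈_; -_; 0#; 1#; 0≉1; inverse; ring; *-commutativeMonoid;
    +-cong; +-congʳ; +-congˡ; *-congʳ; *-congˡ; +-comm; +-assoc; *-comm; *-assoc; zeroˡ; zeroʳ;
    distribˡ; distribʳ; +-identityˡ; +-identityʳ; *-identityˡ; *-identityʳ; -‿inverseˡ; -‿inverseʳ; -‿cong)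
    renaming (_+_ to infixl 6 _+ᴸ_; _*_ to infixl 7 _*ᴸ_; refl to ≈-refl; sym to ≈-sym; trans to ≈-trans)
  open Algebra.Properties.Ring ring using (-‿distribˡ-*)
  open RingMorphisms.IsRingHomomorphism ι-embedding using (⟦⟧-cong; +-homo; *-homo; 0#-homo; 1#-homo; -‿homo)

  lvl : Level
  lvl = k ⊔ kℓ ⊔ l ⊔ lℓ

  record IsSubspace (P : Carrier → Set lvl) : Set lvl where
    field
      stable : ∀ {x} → ¬ ¬ P x → P x
      resp-≈ : ∀ {x y} → x ≈ y → P x → P y
      zero∈  : P 0#
      +-closed : ∀ {x y} → P x → P y → P (x +ᴸ y)
      ι-closed : ∀ {x} c → P x → P (ι c *ᴸ x)

    neg-closed : ∀ {x} → P x → P (- x)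
    neg-closed {x} p = resp-≈ (≈-trans (*-congʳ (≈-trans (-‿homo K.1#) (-‿cong 1#-homo)))
      (≈-trans (≈-sym (-‿distribˡ-* 1# x)) (-‿cong (*-identityˡ x)))) (ι-closed (K.- K.1#) p)

  open IsSubspace

  exchange-+ : ∀ u v u′ v′ → (u +ᴸ v) +ᴸ (u′ +ᴸ v′) ≈ (u +ᴸ u′) +ᴸ (v +ᴸ v′)
  exchange-+ u v u′ v′ = ≈-trans (+-assoc u v _) (≈-trans
    (+-congˡ (≈-trans (≈-sym (+-assoc v u′ v′)) (≈-trans (+-congʳ (+-comm v u′)) (+-assoc u′ v v′)))) (≈-sym (+-assoc u u′ _)))

  exchange-* : ∀ x y z → x *ᴸ (y *ᴸ z) ≈ y *ᴸ (x *ᴸ z)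
  exchange-* x y z = ≈-trans (≈-sym (*-assoc x y z)) (≈-trans (*-congʳ (*-comm x y)) (*-assoc y x z))

  shift-isSubspace : ∀ {P} u → IsSubspace P → IsSubspace (λ x → P (u *ᴸ x))
  shift-isSubspace u P = record
    { stable = stable P
    ; resp-≈ = λ e → resp-≈ P (*-congˡ e)
    ; zero∈ = resp-≈ P (≈-sym (zeroʳ u)) (zero∈ P)
    ; +-closed = λ p q → resp-≈ P (≈-sym (distribˡ u _ _)) (+-closed P p q)
    ; ι-closed = λ c p → resp-≈ P (exchange-* (ι c) u _) (ι-closed P c p)
    }

  sum : (P Q : Carrier → Set lvl) → Carrier → Set lvl
  sum P Q x = ¬ ¬ (∃₂ λ u v → P u × Q v × x ≈ u +ᴸ v)

  sum-isSubspace : ∀ {P Q} → IsSubspace P → IsSubspace Q → IsSubspace (sum P Q)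
  sum-isSubspace P Q = record
    { stable = λ h k → h λ h′ → h′ k
    ; resp-≈ = λ e h k → h λ (u , v , p , q , e′) → k (u , v , p , q , ≈-trans (≈-sym e) e′)
    ; zero∈ = return (0# , 0# , zero∈ P , zero∈ Q , ≈-sym (+-identityˡ 0#))
    ; +-closed = λ h h′ → h >>= λ (u , v , p , q , e) → h′ >>= λ (u′ , v′ , p′ , q′ , e′) →
        return (u +ᴸ u′ , v +ᴸ v′ , +-closed P p p′ , +-closed Q q q′ , ≈-trans (+-cong e e′) (exchange-+ u v u′ v′))
    ; ι-closed = λ c h → h >>= λ (u , v , p , q , e) →
        return (ι c *ᴸ u , ι c *ᴸ v , ι-closed P c p , ι-closed Q c q , ≈-trans (*-congˡ e) (distribˡ (ι c) u v))
    }

  line : Carrier → Carrier → Set lvl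
  line x y = Lift lvl (¬ ¬ (∃ λ c → y ≈ ι c *ᴸ x))

  line-isSubspace : ∀ x → IsSubspace (line x)
  line-isSubspace x = record
    { stable = λ h → lift λ k → h λ h′ → lower h′ k
    ; resp-≈ = λ e (lift h) → lift (h >>= λ (c , e′) → return (c , ≈-trans (≈-sym e) e′))
    ; zero∈ = lift (return (K.0# , ≈-sym (≈-trans (*-congʳ 0#-homo) (zeroˡ x))))
    ; +-closed = λ (lift h) (lift h′) → lift (h >>= λ (c , e) → h′ >>= λ (c′ , e′) →
        return (c K.+ c′ , ≈-trans (+-cong e e′) (≈-trans (≈-sym (distribʳ x (ι c) (ι c′))) (*-congʳ (≈-sym (+-homo c c′))))))
    ; ι-closed = λ a (lift h) → lift (h >>= λ (c , e) →
        return (a K.* c , ≈-trans (*-congˡ e) (≈-trans (≈-sym (*-assoc (ι a) (ι c) x)) (*-congʳ (≈-sym (*-homo a c))))))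
    }

  nil-isSubspace : IsSubspace (λ x → Lift lvl (¬ ¬ (x ≈ 0#)))
  nil-isSubspace = record
    { stable = λ h → lift λ k → h λ h′ → lower h′ k
    ; resp-≈ = λ e (lift h) → lift (h >>= λ e′ → return (≈-trans (≈-sym e) e′))
    ; zero∈ = lift (return ≈-refl)
    ; +-closed = λ (lift h) (lift h′) → lift (h >>= λ e → h′ >>= λ e′ → return (≈-trans (+-cong e e′) (+-identityˡ 0#)))
    ; ι-closed = λ c (lift h) → lift (h >>= λ e → return (≈-trans (*-congˡ e) (zeroʳ (ι c))))
    }

  line-atom : ∀ {x y} → line x y → ¬ Lift lvl (¬ ¬ (y ≈ 0#)) → line y x
  line-atom {x} {y} (lift h) y≉0 = lift (h >>= λ (c , e) →
    let (c′ , cc′) = K.inverse c λ c≈0 → y≉0 (lift (return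
                       (≈-trans e (≈-trans (*-congʳ (≈-trans (⟦⟧-cong c≈0) 0#-homo)) (zeroˡ x)))))
    in return (c′ , ≈-sym (≈-trans (*-congˡ e) (≈-trans (≈-sym (*-assoc (ι c′) (ι c) x)) (≈-trans
         (*-congʳ (≈-trans (≈-sym (*-homo c′ c)) (≈-trans (⟦⟧-cong (K.trans (K.*-comm c′ c) cc′)) 1#-homo))) (*-identityˡ x))))))

  geometry : Geometry l lℓ lvl lvl
  geometry = record
    { subspaces = record
      { commutativeMonoid = *-commutativeMonoid
      ; IsSub  = IsSubspace
      ; stable = stable
      ; resp-≈ = resp-≈
      ; ∩-isSub = λ P Q → record
          { stable = λ h → stable P (λ k → h (k ∘ proj₁)) , stable Q (λ k → h (k ∘ proj₂))
          ; resp-≈ = λ e (p , q) → resp-≈ P e p , resp-≈ Q e q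
          ; zero∈ = zero∈ P , zero∈ Q
          ; +-closed = λ (p , q) (p′ , q′) → +-closed P p p′ , +-closed Q q q′
          ; ι-closed = λ c (p , q) → ι-closed P c p , ι-closed Q c q
          }
      ; ∶-isSub = λ X C → let S = λ x → shift-isSubspace x C in record
          { stable = λ h x x∈ → stable (S x) λ k → h λ f → k (f x x∈)
          ; resp-≈ = λ e f x x∈ → resp-≈ (S x) e (f x x∈)
          ; zero∈ = λ x _ → zero∈ (S x)
          ; +-closed = λ f g x x∈ → +-closed (S x) (f x x∈) (g x x∈)
          ; ι-closed = λ c f x x∈ → ι-closed (S x) c (f x x∈)
          }
      ; shift-isSub = shift-isSubspace
      }
    ; 𝟎 = _ , nil-isSubspace
    ; 𝟏 = (λ _ → ⊤) , record
          { stable = λ _ → tt ; resp-≈ = λ _ _ → tt ; zero∈ = tt ; +-closed = λ _ _ → tt ; ι-closed = λ _ _ → tt }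
    ; 𝟎-least = λ (_ , P) (lift h) → stable P (h >>= λ e → return (resp-≈ P (≈-sym e) (zero∈ P)))
    ; 𝟏-greatest = tt
    ; _∨_ = λ (_ , P) (_ , Q) → _ , sum-isSubspace P Q
    ; ∨-left = λ _ (_ , Q) {x} p → return (x , 0# , p , zero∈ Q , ≈-sym (+-identityʳ x))
    ; ∨-right = λ (_ , P) _ {x} q → return (0# , x , zero∈ P , q , ≈-sym (+-identityˡ x))
    ; ∨-least = λ _ _ (_ , R) P⊆ Q⊆ h → stable R (h >>= λ (u , v , p , q , e) →
        return (resp-≈ R (≈-sym e) (+-closed R (P⊆ p) (Q⊆ q))))
    -- With x = u + v, x in R and v in Q ⊆ R, the component u = x - v lies in R.
    ; modular = λ _ _ (_ , R) Q⊆R {x} (r , h) → h >>= λ (u , v , p , q , e) →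
        return (u , v , (resp-≈ R (≈-trans (+-congʳ e) (≈-trans (+-assoc u v (- v))
          (≈-trans (+-congˡ (-‿inverseʳ v)) (+-identityʳ u)))) (+-closed R r (neg-closed R (Q⊆R q))) , p) , q , e)
    ; ⟨_⟩ = λ x → _ , line-isSubspace x
    ; ⟨⟩-self = λ x → lift (return (K.1# , ≈-sym (≈-trans (*-congʳ 1#-homo) (*-identityˡ x))))
    ; ⟨⟩-least = λ (_ , P) x p (lift h) → stable P (h >>= λ (c , e) → return (resp-≈ P (≈-sym e) (ι-closed P c p)))
    ; ⟨⟩-atom = line-atom
    ; ε∉𝟎 = λ (lift h) → h λ e → 0≉1 (≈-sym e)
    ; invertible = λ {x} x≉0 → inverse x λ e → x≉0 (lift (return e))
    }

  open Geometry geometry using (Sub; _∋_; _⊆_; isSub; 𝟏)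
  open Dimension geometry
  open FlagConstraints geometry

  comb : ∀ {d} → (Fin d → K.Carrier) → (Fin d → Carrier) → Carrier
  comb = lincomb K L ι

  Span⇒ : ∀ d {w x} → Span d w ∋ x → ¬ ¬ ∃ λ c → x ≈ comb c w
  Span⇒ zero    (lift h) = h >>= λ e → return ((λ ()) , e)
  Span⇒ (suc d) h = h >>= λ (u , v , p , lift q , e) → Span⇒ d p >>= λ (c , e₁) → q >>= λ (c₀ , e₂) →
    return (c₀ VF.∷ c , ≈-trans e (≈-trans (+-cong e₁ e₂) (+-comm _ _)))

  Span⇐ : ∀ d {w x} c → x ≈ comb c w → Span d w ∋ x
  Span⇐ zero    c e = lift (return e)
  Span⇐ (suc d) c e = return (_ , _ , Span⇐ d (c ∘ fsuc) ≈-refl ,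
    lift (return (c fzero , ≈-refl)) , ≈-trans e (+-comm _ _))

  -- If the first vector were a combination of the others, there would be a relation whose first
  -- coefficient is -1, forcing 1 = 0 in K. Relations among the others are relations among all,
  -- padded by 0.
  Indep-LinIndep : ∀ d {w} → LinIndep K L ι w → Indep d w
  Indep-LinIndep zero    ind = tt
  Indep-LinIndep (suc d) {w} ind =
    (λ h → Span⇒ d h λ (c , e) → K.0≉1 (K.sym (1≈0 (ind (K.- K.1# VF.∷ c) (cancels c e) fzero)))) ,
    Indep-LinIndep d λ c e s → ind (K.0# VF.∷ c)
      (≈-trans (+-cong (≈-trans (*-congʳ 0#-homo) (zeroˡ (w fzero))) e) (+-identityˡ 0#)) (fsuc s)
    where
    1≈0 : K.- K.1# K.≈ K.0# → K.1# K.≈ K.0#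
    1≈0 e = K.trans (K.sym (K.+-identityʳ _)) (K.trans (K.+-congˡ (K.sym e)) (K.-‿inverseʳ K.1#))
    cancels : ∀ c → w fzero ≈ comb c (w ∘ fsuc) → ι (K.- K.1#) *ᴸ w fzero +ᴸ comb c (w ∘ fsuc) ≈ 0#
    cancels c e = ≈-trans (+-cong (≈-trans (*-congʳ (≈-trans (-‿homo K.1#) (-‿cong 1#-homo)))
      (≈-trans (≈-sym (-‿distribˡ-* 1# (w fzero))) (-‿cong (*-identityˡ (w fzero))))) (≈-sym e)) (-‿inverseˡ (w fzero))

  HasDim⇒Dim : ∀ {p d} {P : Carrier → Set p} (S : Sub) → (∀ {x} → P x → S ∋ x) → (∀ {x} → S ∋ x → ¬ ¬ P x) →
               HasDim K L ι P d → Dim S d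
  HasDim⇒Dim {d = d} S P⇒S S⇒P (w , w∈ , ind , spans) = Dim-cong {d} {Span d w} {S}
    ( Span-least d S (λ s → P⇒S (w∈ s))
    , λ h → stable (isSub (Span d w)) (S⇒P h >>= λ p → let (c , e) = spans _ p in return (Span⇐ d c e)))
    (Dim-Span d (Indep-LinIndep d ind))

  -- `InFF` uses coefficient vectors of full length n that vanish beyond i, whereas `Span` uses only
  -- the first i + 1 basis vectors; padding by zeros translates between the two.
  extend : ∀ {m n} → m ≤ n → (Fin m → K.Carrier) → Fin n → K.Carrier
  extend z≤n       c b        = K.0#
  extend (s≤s m≤n) c fzero    = c fzero
  extend (s≤s m≤n) c (fsuc b) = extend m≤n (c ∘ fsuc) b

  extend-zero : ∀ {m n} (m≤n : m ≤ n) c b → m ≤ toℕ b → extend m≤n c b K.≈ K.0#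
  extend-zero z≤n       c b        _       = K.refl
  extend-zero (s≤s m≤n) c (fsuc b) (s≤s h) = extend-zero m≤n (c ∘ fsuc) b h

  comb-zero : ∀ {n} c (w : Fin n → Carrier) → (∀ b → c b K.≈ K.0#) → comb c w ≈ 0#
  comb-zero {zero}  c w c≈0 = ≈-refl
  comb-zero {suc n} c w c≈0 = ≈-trans (+-cong (≈-trans (*-congʳ (≈-trans (⟦⟧-cong (c≈0 fzero)) 0#-homo)) (zeroˡ _))
    (comb-zero (c ∘ fsuc) (w ∘ fsuc) (c≈0 ∘ fsuc))) (+-identityˡ 0#)

  comb-extend : ∀ {m n} (m≤n : m ≤ n) c (w : Fin n → Carrier) →
                comb (extend m≤n c) w ≈ comb c (λ s → w (inject≤ s m≤n))
  comb-extend z≤n       c w = comb-zero _ w (λ _ → K.refl)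
  comb-extend (s≤s m≤n) c w = +-congˡ (comb-extend m≤n (c ∘ fsuc) (w ∘ fsuc))

  comb-truncate : ∀ {m n} (m≤n : m ≤ n) c (w : Fin n → Carrier) → (∀ b → m ≤ toℕ b → c b K.≈ K.0#) →
                  comb c w ≈ comb (λ s → c (inject≤ s m≤n)) (λ s → w (inject≤ s m≤n))
  comb-truncate z≤n       c w c≈0 = comb-zero c w (λ b → c≈0 b z≤n)
  comb-truncate (s≤s m≤n) c w c≈0 = +-congˡ (comb-truncate m≤n (c ∘ fsuc) (w ∘ fsuc) (λ b h → c≈0 (fsuc b) (s≤s h)))

  LinIndep-initial : ∀ {m n} (m≤n : m ≤ n) {w : Fin n → Carrier} → LinIndep K L ι w → LinIndep K L ι (λ s → w (inject≤ s m≤n))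
  LinIndep-initial m≤n {w} ind c e s = K.trans (K.reflexive (sym (extend-inject m≤n c s)))
    (ind (extend m≤n c) (≈-trans (comb-extend m≤n c w) e) (inject≤ s m≤n))
    where
    extend-inject : ∀ {m n} (m≤n : m ≤ n) c s → extend m≤n c (inject≤ s m≤n) ≡ c s
    extend-inject (s≤s m≤n) c fzero    = refl
    extend-inject (s≤s m≤n) c (fsuc s) = extend-inject m≤n (c ∘ fsuc) s

  module _ {n} (F : FieldFlag K L ι n) where
    open FieldFlag F

    initial : ∀ i → Fin (suc (toℕ i)) → Carrier
    initial i s = v (inject≤ s (Finₚ.toℕ<n i))

    flagSub : Fin n → Sub
    flagSub i = Span (suc (toℕ i)) (initial i)

    flagSub⇒ : ∀ i {x} → flagSub i ∋ x → ¬ ¬ InFF K L ι F i x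
    flagSub⇒ i h = Span⇒ _ {initial i} h >>= λ (c , e) → return
      (extend (Finₚ.toℕ<n i) c , extend-zero (Finₚ.toℕ<n i) c , ≈-trans e (≈-sym (comb-extend (Finₚ.toℕ<n i) c v)))

    flagSub⇐ : ∀ i {x} → InFF K L ι F i x → flagSub i ∋ x
    flagSub⇐ i {x} (c , c≈0 , e) = Span⇐ _ {initial i} (λ s → c (inject≤ s (Finₚ.toℕ<n i)))
      (≈-trans e (comb-truncate (Finₚ.toℕ<n i) c v c≈0))

    Dim-flagSub : ∀ i → Dim (flagSub i) (suc (toℕ i))
    Dim-flagSub i = Dim-Span (suc (toℕ i)) {initial i}
      (Indep-LinIndep (suc (toℕ i)) {initial i} (LinIndep-initial (Finₚ.toℕ<n i) v-indep))

    Dim-𝟏 : Dim 𝟏 n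
    Dim-𝟏 = HasDim⇒Dim {P = 𝟏 ∋_} 𝟏 id return (v , (λ _ → tt) , v-indep , λ x _ → v-span x)

    1∈flagSub : ∀ i → flagSub i ∋ 1#
    1∈flagSub i = resp-≈ (isSub (flagSub i)) (v-one b (Finₚ.toℕ-inject≤ {suc (toℕ i)} fzero _))
      (Span-self (suc (toℕ i)) {initial i} fzero)
      where b = inject≤ {suc (toℕ i)} fzero (Finₚ.toℕ<n i)

    open Finite Dim-𝟏

    generated : ∀ i {d} → HasDim K L ι (FGen K L ι F i) d → Generated Dim-𝟏 (flagSub i) d
    generated i size = record
      { E = E
      ; isSubfield = record { unit = return (resp 1#-homo (scal K.1#)) ; closed = λ x∈ y∈ → x∈ >>= λ x → y∈ >>= λ y → return (mul x y) }
      ; dim-E = HasDim⇒Dim E return id size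
      ; P⊆E = λ x∈ → flagSub⇒ i x∈ >>= λ x → return (gen x)
      ; least = λ H H-sub P⊆H x∈ → stable (isSub H) (x∈ >>= λ x → return (least H H-sub P⊆H x)) }
      where
      E : Sub
      E = (λ x → ¬ ¬ FGen K L ι F i x) , record
        { stable = λ h k → h λ h′ → h′ k
        ; resp-≈ = λ e h → h >>= λ g → return (resp e g)
        ; zero∈ = return (resp 0#-homo (scal K.0#))
        ; +-closed = λ h h′ → h >>= λ g → h′ >>= λ g′ → return (add g g′)
        ; ι-closed = λ c h → h >>= λ g → return (mul (scal c) g) }
      least : ∀ H → IsSubfield H → flagSub i ⊆ H → ∀ {x} → FGen K L ι F i x → H ∋ x
      least H H-sub P⊆H (gen x∈)   = P⊆H (flagSub⇐ i x∈)
      least H H-sub P⊆H (scal c)   = resp-≈ (isSub H) (*-identityʳ (ι c)) (ι-closed (isSub H) c (IsSubfield.unit H-sub))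
      least H H-sub P⊆H (add x y)  = +-closed (isSub H) (least H H-sub P⊆H x) (least H H-sub P⊆H y)
      least H H-sub P⊆H (neg x)    = neg-closed (isSub H) (least H H-sub P⊆H x)
      least H H-sub P⊆H (mul x y)  = IsSubfield.closed H-sub (least H H-sub P⊆H x) (least H H-sub P⊆H y)
      least H H-sub P⊆H (inv x e)  = IsSubfield.inverse-closed H-sub (least H H-sub P⊆H x) e
      least H H-sub P⊆H (resp e x) = resp-≈ (isSub H) e (least H H-sub P⊆H x)

    field-constraints : ∀ {i j m gᵢ gⱼ} → FProdSub K L ι F i j m →
                        HasDim K L ι (FGen K L ι F i) gᵢ → HasDim K L ι (FGen K L ι F j) gⱼ →
                        ¬ ¬ Constraints n (toℕ i) (toℕ j) (toℕ m) gᵢ gⱼ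
    field-constraints {i} {j} {m} ij⊆m sᵢ sⱼ =
      constraints Dim-𝟏 {flagSub i} {flagSub j} {flagSub m} (Dim-flagSub i) (Dim-flagSub j) (Dim-flagSub m) (1∈flagSub i) (1∈flagSub j)
        (λ x∈ y∈ → stable (isSub (flagSub m)) (flagSub⇒ i x∈ >>= λ x → flagSub⇒ j y∈ >>= λ y →
          return (flagSub⇐ m (ij⊆m _ _ x y)))) (generated i sᵢ) (generated j sⱼ)

-- Mixed radix addition

maxUpTo-least : ∀ i f {m} → (∀ a → a ≤ i → f a ≤ m) → maxUpTo i f ≤ m
maxUpTo-least zero    f f≤ = f≤ 0 z≤n
maxUpTo-least (suc i) f f≤ = ℕₚ.⊔-lub (maxUpTo-least i f λ a a≤i → f≤ a (ℕₚ.m≤n⇒m≤1+n a≤i)) (f≤ (suc i) ℕₚ.≤-refl)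

T𝔗-least : ∀ 𝔗 i j {m} → (∀ {a b} → a ≤ i → b ≤ j → radixAdd 𝔗 a b ≤ m) → T𝔗 𝔗 i j ≤ m
T𝔗-least 𝔗 i j f = maxUpTo-least i _ λ a a≤i → maxUpTo-least j _ λ b b≤j → f a≤i b≤j

radixAdd-≤-+ : ∀ 𝔗 a b → radixAdd 𝔗 a b ≤ a + b
radixAdd-≤-+ []           a b = z≤n
radixAdd-≤-+ (zero ∷ ms)  a b = z≤n
radixAdd-≤-+ (suc m ∷ ms) a b = begin
  (a % M + b % M) % M + M * radixAdd ms (a / M) (b / M)
    ≤⟨ ℕₚ.+-mono-≤ (m%n≤m (a % M + b % M) M) (ℕₚ.*-monoʳ-≤ M (radixAdd-≤-+ ms (a / M) (b / M))) ⟩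
  a % M + b % M + M * (a / M + b / M)
    ≡⟨ rearrange (a % M) (b % M) M (a / M) (b / M) ⟩
  (a % M + a / M * M) + (b % M + b / M * M)
    ≡⟨ cong₂ _+_ (m≡m%n+[m/n]*n a M) (m≡m%n+[m/n]*n b M) ⟨
  a + b ∎
  where
  open ℕₚ.≤-Reasoning
  M = suc m
  rearrange : ∀ r s M p q → r + s + M * (p + q) ≡ (r + p * M) + (s + q * M)
  rearrange = solve-∀

radixAdd-+-1-< : ∀ 𝔗 {a b x y} → a < x → b < y → radixAdd 𝔗 a b + 1 < x + y
radixAdd-+-1-< 𝔗 {a} {b} {x} {y} a<x b<y = begin-strict
  radixAdd 𝔗 a b + 1   ≤⟨ ℕₚ.+-monoˡ-≤ 1 (radixAdd-≤-+ 𝔗 a b) ⟩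
  a + b + 1            ≡⟨ ℕₚ.+-comm (a + b) 1 ⟩
  suc a + b            <⟨ ℕₚ.+-mono-≤-< a<x b<y ⟩
  x + y                ∎
  where open ℕₚ.≤-Reasoning

-- For h = 1 it suffices that dropping carries never increases a sum. Otherwise M divides h, x and
-- y: dividing by M reduces to the remaining radices, and the strict inequality there leaves a full
-- unit M of slack for the lowest digit, which is less than M.
radixAdd-+-< : ∀ 𝔗 {h x y a b} → h ∈ prefixProds 𝔗 → h ∣ x → h ∣ y → a < x → b < y → radixAdd 𝔗 a b + h < x + y
radixAdd-+-< []       (here refl) _ _ a<x b<y = radixAdd-+-1-< [] a<x b<y
radixAdd-+-< (m ∷ ms) (here refl) _ _ a<x b<y = radixAdd-+-1-< (m ∷ ms) a<x b<y
radixAdd-+-< (m ∷ ms) (there h∈) h∣x h∣y a<x b<y with ∈-map⁻ (m *_) h∈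
radixAdd-+-< (zero ∷ ms) _ h∣x h∣y a<x b<y | _ , _ , refl with 0∣⇒≡0 h∣x
... | refl = contradiction a<x λ ()
radixAdd-+-< (suc m ∷ ms) {a = a} {b} _ (divides X refl) (divides Y refl) a<x b<y | h , h∈ , refl = begin-strict
  (a % M + b % M) % M + M * R + M * h   <⟨ ℕₚ.+-monoˡ-< (M * h) (ℕₚ.+-monoˡ-< (M * R) (m%n<n (a % M + b % M) M)) ⟩
  M + M * R + M * h                     ≡⟨ rearrange M R h ⟩
  M * suc (R + h)                       ≤⟨ ℕₚ.*-monoʳ-≤ M (radixAdd-+-< ms h∈ (divides X refl) (divides Y refl) (quotient X a<x) (quotient Y b<y)) ⟩
  M * (X * h + Y * h)                   ≡⟨ distribute M X Y h ⟩
  X * (M * h) + Y * (M * h)             ∎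
  where
  open ℕₚ.≤-Reasoning
  M = suc m
  R = radixAdd ms (a / M) (b / M)
  rearrange : ∀ M R h → M + M * R + M * h ≡ M * (1 + (R + h))
  rearrange = solve-∀
  distribute : ∀ M X Y h → M * (X * h + Y * h) ≡ X * (M * h) + Y * (M * h)
  distribute = solve-∀
  swap : ∀ M X h → X * (M * h) ≡ X * h * M
  swap = solve-∀
  quotient : ∀ {a} X → a < X * (M * h) → a / M < X * h
  quotient {a} X a<x = m<n*o⇒m/o<n (subst (a <_) (swap M X h) a<x)

1∈prefixProds : ∀ 𝔗 → 1 ∈ prefixProds 𝔗
1∈prefixProds []       = here refl
1∈prefixProds (_ ∷ _) = here refl

product∈prefixProds : ∀ 𝔗 → product 𝔗 ∈ prefixProds 𝔗
product∈prefixProds []       = here refl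
product∈prefixProds (m ∷ ms) = there (∈-map⁺ (m *_) (product∈prefixProds ms))

radixAdd-<-product : ∀ 𝔗 {a b} → a < product 𝔗 → b < product 𝔗 → radixAdd 𝔗 a b < product 𝔗
radixAdd-<-product 𝔗 {a} {b} a<n b<n = ℕₚ.+-cancelʳ-< (product 𝔗) (radixAdd 𝔗 a b) (product 𝔗)
  (radixAdd-+-< 𝔗 (product∈prefixProds 𝔗) (divides 1 (sym (ℕₚ.*-identityˡ _))) (divides 1 (sym (ℕₚ.*-identityˡ _))) a<n b<n)

-- Divisors of n and prefix products

prime-∣-* : ∀ {p h m} → Prime p → h ∣ p * m → (∃ λ h′ → h ≡ p * h′ × h′ ∣ m) ⊎ h ∣ m
prime-∣-* {p} {h} {m} pr h∣pm with p ∣? h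
... | yes (divides q refl) = inj₁ (q , ℕₚ.*-comm q p ,
        *-cancelˡ-∣ p {{prime⇒nonZero pr}} (subst (_∣ p * m) (ℕₚ.*-comm q p) h∣pm))
... | no p∤h = inj₂ (coprime-divisor coprime h∣pm)
  where
  coprime : Coprime h p
  coprime (d∣h , d∣p) with prime⇒irreducible pr d∣p
  ... | inj₁ d≡1  = d≡1
  ... | inj₂ refl = contradiction d∣h p∤h

prime-power-prefix : ∀ {p h 𝔗} → Prime p → All (_≡ p) 𝔗 → h ∣ product 𝔗 → h ∈ prefixProds 𝔗
prime-power-prefix pr []          h∣1 = here (∣1⇒≡1 h∣1)
prime-power-prefix {p} {𝔗 = _ ∷ ms} pr (refl ∷ eqs) h∣ with prime-∣-* pr h∣
... | inj₁ (h′ , refl , h′∣) = there (∈-map⁺ (p *_) (prime-power-prefix pr eqs h′∣))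
... | inj₂ h∣ms = cons eqs (prime-power-prefix pr eqs h∣ms)
  where
  -- Prepending p keeps every prefix product only because all radices are equal: a product of s
  -- radices does not depend on where it starts.
  cons : ∀ {h ms} → All (_≡ p) ms → h ∈ prefixProds ms → h ∈ prefixProds (p ∷ ms)
  cons []           (here refl) = here refl
  cons (refl ∷ eqs) (here refl) = here refl
  cons {ms = _ ∷ ms} (refl ∷ eqs) (there h∈) with ∈-map⁻ (p *_) h∈
  ... | h′ , h′∈ , refl = there (∈-map⁺ (p *_) (cons eqs h′∈))

prime-pair-divisor : ∀ {q p h} → Prime q → Prime p → h ∣ product (q ∷ p ∷ []) → h ∈ prefixProds (q ∷ p ∷ []) ⊎ h ≡ p
prime-pair-divisor {q} prq prp h∣ with prime-∣-* prq h∣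
... | inj₁ (h′ , refl , h′∣) = inj₁ (there (∈-map⁺ (q *_) (prime-power-prefix prp (refl ∷ []) h′∣)))
... | inj₂ h∣p with prime-power-prefix prp (refl ∷ []) h∣p
...   | here refl         = inj₁ (here refl)
...   | there (here refl) = inj₂ (ℕₚ.*-identityʳ _)

-- The test runs over all candidates 0, ..., n and is discharged by evaluation when n and `ds` are
-- concrete.
divisor∈ : ∀ n ds .{{_ : NonZero n}} → True (Finₚ.all? {suc n} λ h → (toℕ h ∣? n) →-dec (toℕ h ∈? ds)) →
           ∀ {h} → h ∣ n → h ∈ ds
divisor∈ n ds check h∣n = subst (λ h → h ∣ n → h ∈ ds) (Finₚ.toℕ-fromℕ< (s≤s (∣⇒≤ h∣n)))
  (toWitness check (fromℕ< (s≤s (∣⇒≤ h∣n)))) h∣n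

-- The tower types sorted by which divisors of n fail to be prefix products: none for `prime-power`;
-- at most p for `prime-pair`; 2 for `[4]`; 2 and 3 for `[6]`; 4 for `[2,4]`; 2 for `[4,2]`. The
-- bound q ≤ 3 says that three times the exceptional divisor p reaches n = qp.
data Kind : List ℕ → Set where
  prime-power : ∀ {p 𝔗} → Prime p → All (_≡ p) 𝔗 → Kind 𝔗
  prime-pair  : ∀ {q p} → q ≤ 3 → Prime q → Prime p → Kind (q ∷ p ∷ [])
  [4]   : Kind (4 ∷ [])
  [6]   : Kind (6 ∷ [])
  [2,4] : Kind (2 ∷ 4 ∷ [])
  [4,2] : Kind (4 ∷ 2 ∷ [])

-- Lower bounds for k according to the degree of the stabiliser

module Bounds {𝔗 i j k gᵢ gⱼ} (constraints : Constraints (product 𝔗) i j k gᵢ gⱼ)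
         (gᵢ∈ : gᵢ ∈ prefixProds 𝔗) (gⱼ∈ : gⱼ ∈ prefixProds 𝔗)
         (i<n : i < product 𝔗) (j<n : j < product 𝔗) {a b} (a≤i : a ≤ i) (b≤j : b ≤ j) where
  open Constraints constraints

  private
    a<x : a < x
    a<x = ℕₚ.≤-<-trans a≤i i<x
    b<y : b < y
    b<y = ℕₚ.≤-<-trans b≤j j<y

    ∣⇒≤-pos : ∀ {m x i} → i < x → m ∣ x → m ≤ x
    ∣⇒≤-pos (s≤s _) = ∣⇒≤

  x≤1+k : x ≤ suc k
  x≤1+k = ℕₚ.+-cancelˡ-≤ h x (suc k) (ℕₚ.≤-trans (ℕₚ.≤-trans (ℕₚ.≤-reflexive (ℕₚ.+-comm h x)) (ℕₚ.+-monoʳ-≤ x (∣⇒≤-pos j<y h∣y))) bound)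

  y≤1+k : y ≤ suc k
  y≤1+k = ℕₚ.+-cancelˡ-≤ h y (suc k) (ℕₚ.≤-trans (ℕₚ.+-monoˡ-≤ y (∣⇒≤-pos i<x h∣x)) bound)

  prefix-case : h ∈ prefixProds 𝔗 → radixAdd 𝔗 a b ≤ k
  prefix-case h∈ = s≤s⁻¹ (ℕₚ.+-cancelʳ-< h (radixAdd 𝔗 a b) (suc k)
    (ℕₚ.<-≤-trans (radixAdd-+-< 𝔗 h∈ h∣x h∣y a<x b<y) (ℕₚ.≤-trans bound (ℕₚ.≤-reflexive (ℕₚ.+-comm h (suc k))))))

  -- For a below a prefix product g, the mixed radix inequality with g in place of both h and x
  -- gives a ⊕ b < y, and y ≤ k + 1 because x is at least h. With g = 1 this settles i = 0.
  left-case : ∀ {g} → g ∈ prefixProds 𝔗 → g ∣ y → a < g → radixAdd 𝔗 a b ≤ k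
  left-case {g} g∈ g∣y a<g = s≤s⁻¹ (ℕₚ.<-≤-trans (ℕₚ.+-cancelʳ-< g (radixAdd 𝔗 a b) y
    (ℕₚ.<-≤-trans (radixAdd-+-< 𝔗 g∈ (divides 1 (sym (ℕₚ.*-identityˡ g))) g∣y a<g b<y) (ℕₚ.≤-reflexive (ℕₚ.+-comm g y)))) y≤1+k)

  right-case : ∀ {g} → g ∈ prefixProds 𝔗 → g ∣ x → b < g → radixAdd 𝔗 a b ≤ k
  right-case {g} g∈ g∣x b<g = s≤s⁻¹ (ℕₚ.<-≤-trans (ℕₚ.+-cancelʳ-< g (radixAdd 𝔗 a b) x
    (radixAdd-+-< 𝔗 g∈ g∣x (divides 1 (sym (ℕₚ.*-identityˡ g))) a<x b<g)) x≤1+k)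

  full-case : product 𝔗 ≤ suc k → radixAdd 𝔗 a b ≤ k
  full-case n≤ = s≤s⁻¹ (ℕₚ.<-≤-trans (radixAdd-<-product 𝔗 (ℕₚ.≤-<-trans a≤i i<n) (ℕₚ.≤-<-trans b≤j j<n)) n≤)

  private
    2h≤ : ∀ {x i} → i < x → h ∣ x → x ≢ h → h + h ≤ x
    2h≤ i<x (divides zero          refl) x≢h = contradiction i<x λ ()
    2h≤ i<x (divides (suc zero)    refl) x≢h = contradiction (ℕₚ.*-identityˡ h) x≢h
    2h≤ i<x (divides (suc (suc q)) refl) x≢h = ℕₚ.+-monoʳ-≤ h (ℕₚ.m≤m+n h (q * h))

  x≥2h : ¬ gᵢ ∣ h → h + h ≤ x
  x≥2h ∤h = 2h≤ i<x h∣x (∤h ∘ gᵢ∣h)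

  y≥2h : ¬ gⱼ ∣ h → h + h ≤ y
  y≥2h ∤h = 2h≤ j<y h∣y (∤h ∘ gⱼ∣h)

  proper-bound : ¬ gᵢ ∣ h → ¬ gⱼ ∣ h → h + h + h ≤ suc k
  proper-bound ∤ᵢ ∤ⱼ = ℕₚ.+-cancelˡ-≤ h (h + h + h) (suc k) (begin
    h + (h + h + h)     ≡⟨ assoc h ⟩
    h + h + (h + h)     ≤⟨ ℕₚ.+-mono-≤ (x≥2h ∤ᵢ) (y≥2h ∤ⱼ) ⟩
    x + y               ≤⟨ bound ⟩
    h + suc k           ∎)
    where
    open ℕₚ.≤-Reasoning
    assoc : ∀ h → h + (h + h + h) ≡ h + h + (h + h)
    assoc = solve-∀

  -- For i = 0 or j = 0 one factor is trivial. Otherwise neither generated degree divides h, both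
  -- modules have dimension at least 2h, and n ≤ 3h ≤ k + 1.
  proper-case : (∀ {i g} → g ∈ prefixProds 𝔗 → 1 ≤ i → i < g → ¬ g ∣ h) → product 𝔗 ≤ h + h + h → radixAdd 𝔗 a b ≤ k
  proper-case ∤h n≤3h with 1 ≤? i | 1 ≤? j
  ... | no i≱1 | _      = left-case (1∈prefixProds 𝔗) (1∣ _) (ℕₚ.≤-<-trans a≤i (ℕₚ.≰⇒> i≱1))
  ... | _      | no j≱1 = right-case (1∈prefixProds 𝔗) (1∣ _) (ℕₚ.≤-<-trans b≤j (ℕₚ.≰⇒> j≱1))
  ... | yes i≥1 | yes j≥1 = full-case (ℕₚ.≤-trans n≤3h (proper-bound (∤h gᵢ∈ i≥1 i<gᵢ) (∤h gⱼ∈ j≥1 j<gⱼ)))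

module _ {i j k gᵢ gⱼ a b : ℕ} (a≤i : a ≤ i) (b≤j : b ≤ j) where

  radixAdd-≤ : ∀ {𝔗} → Kind 𝔗 → Constraints (product 𝔗) i j k gᵢ gⱼ →
               gᵢ ∈ prefixProds 𝔗 → gⱼ ∈ prefixProds 𝔗 → i < product 𝔗 → j < product 𝔗 → radixAdd 𝔗 a b ≤ k
  radixAdd-≤ (prime-power pr eqs) C gᵢ∈ gⱼ∈ i<n j<n = prefix-case (prime-power-prefix pr eqs h∣n)
    where
    open Constraints C
    open Bounds C gᵢ∈ gⱼ∈ i<n j<n a≤i b≤j
  radixAdd-≤ {𝔗} (prime-pair {q} {p} q≤3 prq prp) C gᵢ∈ gⱼ∈ i<n j<n with prime-pair-divisor prq prp (Constraints.h∣n C) | q ≟ p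
  ... | inj₁ h∈  | _        = Bounds.prefix-case {𝔗} C gᵢ∈ gⱼ∈ i<n j<n a≤i b≤j h∈
  -- For q = p the divisor p is a prefix product after all.
  ... | inj₂ h≡p | yes refl = Bounds.prefix-case {𝔗} C gᵢ∈ gⱼ∈ i<n j<n a≤i b≤j
                                (prime-power-prefix prp (refl ∷ refl ∷ []) (Constraints.h∣n C))
  ... | inj₂ h≡p | no q≢p   = Bounds.proper-case {𝔗} C gᵢ∈ gⱼ∈ i<n j<n a≤i b≤j
    (λ { (here refl) i≥1 i<g _ → ℕₚ.<⇒≱ i<g i≥1
       ; (there (here refl)) _ _ g∣h → q∤p (∣-trans (divides 1 (ℕₚ.*-comm q 1)) (subst (q * 1 ∣_) h≡p g∣h))
       ; (there (there (here refl))) _ _ g∣h → q∤p (∣-trans (divides (p * 1) (ℕₚ.*-comm q (p * 1))) (subst (q * (p * 1) ∣_) h≡p g∣h)) })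
    (subst (λ h → q * (p * 1) ≤ h + h + h) (sym h≡p) (ℕₚ.≤-trans (ℕₚ.*-monoˡ-≤ (p * 1) q≤3) (ℕₚ.≤-reflexive (triple p))))
    where
    q∤p : ¬ q ∣ p
    q∤p q∣p with prime⇒irreducible prp q∣p
    ... | inj₁ refl = contradiction prq (from-no (prime? 1))
    ... | inj₂ q≡p  = q≢p q≡p
    triple : ∀ p → 3 * (p * 1) ≡ p + p + p
    triple = solve-∀
  radixAdd-≤ {𝔗} [4] C gᵢ∈ gⱼ∈ i<n j<n = cases (divisor∈ 4 (1 ∷ 2 ∷ 4 ∷ []) _ h∣n)
    where
    open Constraints C
    open Bounds {𝔗} C gᵢ∈ gⱼ∈ i<n j<n a≤i b≤j
    cases : h ∈ 1 ∷ 2 ∷ 4 ∷ [] → radixAdd 𝔗 a b ≤ k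
    cases (here e)                 = prefix-case (here e)
    cases (there (there (here e))) = prefix-case (there (here e))
    cases (there (here e))         = proper-case
      (λ { (here refl) i≥1 i<g _ → ℕₚ.<⇒≱ i<g i≥1
         ; (there (here refl)) _ _ g∣h → from-no (4 ∣? 2) (subst (4 ∣_) e g∣h) })
      (subst (λ h → 4 ≤ h + h + h) (sym e) (from-yes (4 ≤? 6)))
  radixAdd-≤ {𝔗} [6] C gᵢ∈ gⱼ∈ i<n j<n = cases (divisor∈ 6 (1 ∷ 2 ∷ 3 ∷ 6 ∷ []) _ h∣n)
    where
    open Constraints C
    open Bounds {𝔗} C gᵢ∈ gⱼ∈ i<n j<n a≤i b≤j
    proper : ∀ {m} → h ≡ m → ¬ 6 ∣ m → 6 ≤ m + m + m → radixAdd 𝔗 a b ≤ k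
    proper e 6∤m 6≤3m = proper-case
      (λ { (here refl) i≥1 i<g _ → ℕₚ.<⇒≱ i<g i≥1
         ; (there (here refl)) _ _ g∣h → 6∤m (subst (6 ∣_) e g∣h) })
      (subst (λ h → 6 ≤ h + h + h) (sym e) 6≤3m)
    cases : h ∈ 1 ∷ 2 ∷ 3 ∷ 6 ∷ [] → radixAdd 𝔗 a b ≤ k
    cases (here e)                         = prefix-case (here e)
    cases (there (there (there (here e)))) = prefix-case (there (here e))
    cases (there (here e))                 = proper e (from-no (6 ∣? 2)) (from-yes (6 ≤? 6))
    cases (there (there (here e)))         = proper e (from-no (6 ∣? 3)) (from-yes (6 ≤? 9))
  radixAdd-≤ {𝔗} [2,4] C gᵢ∈ gⱼ∈ i<n j<n = cases (divisor∈ 8 (1 ∷ 2 ∷ 4 ∷ 8 ∷ []) _ h∣n)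
    where
    open Constraints C
    open Bounds {𝔗} C gᵢ∈ gⱼ∈ i<n j<n a≤i b≤j
    ∤4 : ∀ {i g} → g ∈ 1 ∷ 2 ∷ 8 ∷ [] → 2 ≤ i → i < g → ¬ g ∣ 4
    ∤4 (here refl)                 i≥2 i<g _   = ℕₚ.<⇒≱ i<g (ℕₚ.≤-trans (s≤s z≤n) i≥2)
    ∤4 (there (here refl))         i≥2 i<g _   = ℕₚ.<⇒≱ i<g i≥2
    ∤4 (there (there (here refl))) _   _   g∣h = from-no (8 ∣? 4) g∣h
    cases : h ∈ 1 ∷ 2 ∷ 4 ∷ 8 ∷ [] → radixAdd 𝔗 a b ≤ k
    cases (here e)                         = prefix-case (here e)
    cases (there (here e))                 = prefix-case (there (here e))
    cases (there (there (there (here e)))) = prefix-case (there (there (here e)))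
    cases (there (there (here e))) with 2 ≤? i | 2 ≤? j
    -- For i < 2 the generated degree may be 2, which divides h = 4; but then 2 also divides y, and
    -- the prefix product 2 settles the case. From i = 2 on, the generated degree is 8.
    ... | no i≱2  | _       = left-case (there (here refl)) (∣-trans (divides 2 e) h∣y) (ℕₚ.≤-<-trans a≤i (ℕₚ.≰⇒> i≱2))
    ... | _       | no j≱2  = right-case (there (here refl)) (∣-trans (divides 2 e) h∣x) (ℕₚ.≤-<-trans b≤j (ℕₚ.≰⇒> j≱2))
    ... | yes i≥2 | yes j≥2 = full-case (ℕₚ.≤-trans (from-yes (8 ≤? 12)) (subst (λ h → h + h + h ≤ suc k) e
      (proper-bound (λ g∣h → ∤4 gᵢ∈ i≥2 i<gᵢ (subst (_ ∣_) e g∣h)) (λ g∣h → ∤4 gⱼ∈ j≥2 j<gⱼ (subst (_ ∣_) e g∣h)))))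
  radixAdd-≤ {𝔗} [4,2] C gᵢ∈ gⱼ∈ i<n j<n = cases (divisor∈ 8 (1 ∷ 2 ∷ 4 ∷ 8 ∷ []) _ h∣n)
    where
    open Constraints C
    open Bounds {𝔗} C gᵢ∈ gⱼ∈ i<n j<n a≤i b≤j
    ∤2 : ∀ {i g} → g ∈ 1 ∷ 4 ∷ 8 ∷ [] → 1 ≤ i → i < g → ¬ g ∣ 2
    ∤2 (here refl)                 i≥1 i<g _   = ℕₚ.<⇒≱ i<g i≥1
    ∤2 (there (here refl))         _   _   g∣h = from-no (4 ∣? 2) g∣h
    ∤2 (there (there (here refl))) _   _   g∣h = from-no (8 ∣? 2) g∣h
    -- For h = 2 the bound 3h = 6 falls short of 8. If i or j is at least 4, that module has even
    -- dimension above 4, hence at least 6; the other has at least 4, and 10 ≤ x + y ≤ 2 + (k + 1)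
    -- gives k + 1 ≥ 8. If both are below 4, then a ⊕ b stays below the prefix product 4, and 4 ≤ y
    -- ≤ k + 1.
    ≥6 : ∀ {i x} → 4 ≤ i → i < x → 2 ∣ x → 6 ≤ x
    ≥6 i≥4 i<x (divides q refl) = ℕₚ.*-monoˡ-≤ 2 (ℕₚ.*-cancelʳ-< 2 2 q (ℕₚ.≤-<-trans i≥4 i<x))
    large : h ≡ 2 → 10 ≤ x + y → radixAdd 𝔗 a b ≤ k
    large e 10≤ = full-case (ℕₚ.+-cancelˡ-≤ 2 8 (suc k) (ℕₚ.≤-trans 10≤ (subst (λ h → x + y ≤ h + suc k) e bound)))
    small : a < 4 → b < 4 → 4 ≤ y → radixAdd 𝔗 a b ≤ k
    small a<4 b<4 4≤y = s≤s⁻¹ (ℕₚ.<-≤-trans (ℕₚ.+-cancelʳ-< 4 (radixAdd 𝔗 a b) 4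
      (radixAdd-+-< 𝔗 {x = 4} {4} (there (here refl)) (divides 1 refl) (divides 1 refl) a<4 b<4)) (ℕₚ.≤-trans 4≤y y≤1+k))
    cases : h ∈ 1 ∷ 2 ∷ 4 ∷ 8 ∷ [] → radixAdd 𝔗 a b ≤ k
    cases (here e)                         = prefix-case (here e)
    cases (there (there (here e)))         = prefix-case (there (here e))
    cases (there (there (there (here e)))) = prefix-case (there (there (here e)))
    cases (there (here e)) with 1 ≤? i | 1 ≤? j
    ... | no i≱1  | _       = left-case (here refl) (1∣ _) (ℕₚ.≤-<-trans a≤i (ℕₚ.≰⇒> i≱1))
    ... | _       | no j≱1  = right-case (here refl) (1∣ _) (ℕₚ.≤-<-trans b≤j (ℕₚ.≰⇒> j≱1))
    ... | yes i≥1 | yes j≥1 with 4 ≤? i | 4 ≤? j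
    ...   | yes i≥4 | _       = large e (ℕₚ.+-mono-≤ {6} {x} {4} (≥6 i≥4 i<x (subst (_∣ x) e h∣x))
        (subst (λ h → h + h ≤ y) e (y≥2h λ g∣h → ∤2 gⱼ∈ j≥1 j<gⱼ (subst (_ ∣_) e g∣h))))
    ...   | _       | yes j≥4 = large e (ℕₚ.+-mono-≤ {4} {x} {6}
        (subst (λ h → h + h ≤ x) e (x≥2h λ g∣h → ∤2 gᵢ∈ i≥1 i<gᵢ (subst (_ ∣_) e g∣h))) (≥6 j≥4 j<y (subst (_∣ y) e h∣y)))
    ...   | no i≱4  | no j≱4  = small (ℕₚ.≤-<-trans a≤i (ℕₚ.≰⇒> i≱4)) (ℕₚ.≤-<-trans b≤j (ℕₚ.≰⇒> j≱4))
        (subst (λ h → h + h ≤ y) e (y≥2h λ g∣h → ∤2 gⱼ∈ j≥1 j<gⱼ (subst (_ ∣_) e g∣h)))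

-- Classification of the admissible tower types

product≥1 : ∀ {𝔗} → IsTowerType 𝔗 → 1 ≤ product 𝔗
product≥1 []          = s≤s z≤n
product≥1 (m≥2 ∷ tow) = ℕₚ.*-mono-≤ (ℕₚ.≤-trans (s≤s z≤n) m≥2) (product≥1 tow)

product<2⇒[] : ∀ {𝔗} → IsTowerType 𝔗 → product 𝔗 < 2 → 𝔗 ≡ []
product<2⇒[] []          _ = refl
product<2⇒[] (m≥2 ∷ tow) h = contradiction (ℕₚ.*-mono-≤ m≥2 (product≥1 tow)) (ℕₚ.<⇒≱ h)

product<3 : ∀ {𝔗} → IsTowerType 𝔗 → product 𝔗 < 3 → 𝔗 ≡ [] ⊎ 𝔗 ≡ 2 ∷ []
product<3 [] _ = inj₁ refl
product<3 {2 ∷ ms} (_ ∷ tow) h with product<2⇒[] tow (ℕₚ.*-cancelˡ-< 2 (product ms) 2 (ℕₚ.<-trans h (from-yes (3 <? 4))))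
... | refl = inj₂ refl
product<3 {suc (suc (suc m)) ∷ ms} (_ ∷ tow) h =
  contradiction (ℕₚ.*-mono-≤ {3} {3 + m} {1} (s≤s (s≤s (s≤s z≤n))) (product≥1 tow)) (ℕₚ.<⇒≱ h)
product<3 {suc zero ∷ _} (s≤s () ∷ _)

singleton : ∀ {p ms} → IsTowerType ms → product ms < 2 → Prime p → Kind (p ∷ ms)
singleton tow h pr with product<2⇒[] tow h
... | refl = prime-power pr (refl ∷ [])

classify : ∀ {𝔗} → IsTowerType 𝔗 → product 𝔗 ≤ 8 → 𝔗 ≢ 8 ∷ [] → Kind 𝔗
classify [] _ _ = prime-power prime[2] []
classify {1 ∷ _} (s≤s () ∷ _)
classify {2 ∷ []} _ _ _ = prime-power prime[2] (refl ∷ [])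
classify {2 ∷ 1 ∷ _} (_ ∷ s≤s () ∷ _)
classify {2 ∷ 2 ∷ ms} (_ ∷ _ ∷ tow) h _ with product<3 tow (ℕₚ.*-cancelˡ-< 4 (product ms) 3
  (ℕₚ.≤-<-trans (ℕₚ.≤-trans (ℕₚ.≤-reflexive (ℕₚ.*-assoc 2 2 (product ms))) h) (from-yes (8 <? 12))))
... | inj₁ refl = prime-power prime[2] (refl ∷ refl ∷ [])
... | inj₂ refl = prime-power prime[2] (refl ∷ refl ∷ refl ∷ [])
classify {2 ∷ 3 ∷ ms} (_ ∷ _ ∷ tow) h _ with product<2⇒[] tow (ℕₚ.*-cancelˡ-< 6 (product ms) 2
  (ℕₚ.≤-<-trans (ℕₚ.≤-trans (ℕₚ.≤-reflexive (ℕₚ.*-assoc 2 3 (product ms))) h) (from-yes (8 <? 12))))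
... | refl = prime-pair (s≤s (s≤s z≤n)) prime[2] (from-yes (prime? 3))
classify {2 ∷ 4 ∷ ms} (_ ∷ _ ∷ tow) h _ with product<2⇒[] tow (ℕₚ.*-cancelˡ-< 8 (product ms) 2
  (ℕₚ.≤-<-trans (ℕₚ.≤-trans (ℕₚ.≤-reflexive (ℕₚ.*-assoc 2 4 (product ms))) h) (from-yes (8 <? 16))))
... | refl = [2,4]
classify {2 ∷ suc (suc (suc (suc (suc m)))) ∷ ms} (_ ∷ _ ∷ tow) h _ = contradiction
  (ℕₚ.*-monoʳ-≤ 2 (ℕₚ.*-mono-≤ {5} {5 + m} {1} (s≤s (s≤s (s≤s (s≤s (s≤s z≤n))))) (product≥1 tow)))
  (ℕₚ.<⇒≱ (ℕₚ.≤-<-trans h (from-yes (8 <? 10))))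
classify {3 ∷ ms} (_ ∷ tow) h _ with product<3 tow (ℕₚ.*-cancelˡ-< 3 (product ms) 3 (ℕₚ.≤-<-trans h (from-yes (8 <? 9))))
... | inj₁ refl = prime-power (from-yes (prime? 3)) (refl ∷ [])
... | inj₂ refl = prime-pair (s≤s (s≤s (s≤s z≤n))) (from-yes (prime? 3)) prime[2]
classify {4 ∷ ms} (_ ∷ tow) h _ with product<3 tow (ℕₚ.*-cancelˡ-< 4 (product ms) 3 (ℕₚ.≤-<-trans h (from-yes (8 <? 12))))
... | inj₁ refl = [4]
... | inj₂ refl = [4,2]
classify {5 ∷ ms} (_ ∷ tow) h _ = singleton tow (ℕₚ.*-cancelˡ-< 5 (product ms) 2 (ℕₚ.≤-<-trans h (from-yes (8 <? 10)))) (from-yes (prime? 5))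
classify {6 ∷ ms} (_ ∷ tow) h _ with product<2⇒[] tow (ℕₚ.*-cancelˡ-< 6 (product ms) 2 (ℕₚ.≤-<-trans h (from-yes (8 <? 12))))
... | refl = [6]
classify {7 ∷ ms} (_ ∷ tow) h _ = singleton tow (ℕₚ.*-cancelˡ-< 7 (product ms) 2 (ℕₚ.≤-<-trans h (from-yes (8 <? 14)))) (from-yes (prime? 7))
classify {8 ∷ ms} (_ ∷ tow) h ≢8 with product<2⇒[] tow (ℕₚ.*-cancelˡ-< 8 (product ms) 2 (ℕₚ.≤-<-trans h (from-yes (8 <? 16))))
... | refl = contradiction refl ≢8
classify {suc (suc (suc (suc (suc (suc (suc (suc (suc m)))))))) ∷ ms} (_ ∷ tow) h _ = contradiction
  (ℕₚ.*-mono-≤ {9} {9 + m} {1} (ℕₚ.m≤m+n 9 m) (product≥1 tow)) (ℕₚ.<⇒≱ (s≤s h))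

condition⇒Kind : ∀ {𝔗} → IsTowerType 𝔗 → Condition 𝔗 → Kind 𝔗
condition⇒Kind tow (inj₁ n<8) = classify tow (ℕₚ.<⇒≤ n<8) λ { refl → ℕₚ.<-irrefl refl n<8 }
condition⇒Kind tow (inj₂ (inj₁ (n≡8 , ≢8))) = classify tow (ℕₚ.≤-reflexive n≡8) ≢8
condition⇒Kind tow (inj₂ (inj₂ (inj₁ pr))) = prime-case tow pr
  where
  prime-case : ∀ {𝔗} → IsTowerType 𝔗 → Prime (product 𝔗) → Kind 𝔗
  prime-case [] pr = contradiction pr (from-no (prime? 1))
  prime-case {m ∷ ms} (m≥2 ∷ tow) pr with prime⇒irreducible pr {m} (divides (product ms) (ℕₚ.*-comm m (product ms)))
  ... | inj₁ refl = contradiction m≥2 (from-no (2 ≤? 1))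
  ... | inj₂ m≡n  = singleton tow (s≤s (ℕₚ.≤-reflexive (ℕₚ.*-cancelˡ-≡ (product ms) 1 m {{m≢0}} (trans (sym m≡n) (sym (ℕₚ.*-identityʳ m))))))
                      (subst Prime (sym m≡n) pr)
    where m≢0 = Data.Nat.>-nonZero (ℕₚ.≤-trans (s≤s z≤n) m≥2)
condition⇒Kind tow (inj₂ (inj₂ (inj₂ (inj₁ (p , pr , eqs))))) = prime-power pr eqs
condition⇒Kind tow (inj₂ (inj₂ (inj₂ (inj₂ (inj₁ (p , pr , refl)))))) = prime-pair (s≤s (s≤s z≤n)) prime[2] pr
condition⇒Kind tow (inj₂ (inj₂ (inj₂ (inj₂ (inj₂ (p , pr , refl)))))) = prime-pair ℕₚ.≤-refl (from-yes (prime? 3)) pr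

-- Attained maxima, and mixed radix addition as a group law

maxUpTo-upper : ∀ i f {a} → a ≤ i → f a ≤ maxUpTo i f
maxUpTo-upper zero    f z≤n = ℕₚ.≤-refl
maxUpTo-upper (suc i) f a≤1+i with ℕₚ.m≤n⇒m<n∨m≡n a≤1+i
... | inj₁ a<1+i = ℕₚ.≤-trans (maxUpTo-upper i f (s≤s⁻¹ a<1+i)) (ℕₚ.m≤m⊔n _ _)
... | inj₂ refl  = ℕₚ.m≤n⊔m (maxUpTo i f) (f (suc i))

maxUpTo-attained : ∀ i f → ∃ λ a → a ≤ i × maxUpTo i f ≡ f a
maxUpTo-attained zero    f = 0 , z≤n , refl
maxUpTo-attained (suc i) f with ℕₚ.⊔-sel (maxUpTo i f) (f (suc i)) | maxUpTo-attained i f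
... | inj₁ e | a , a≤i , e′ = a , ℕₚ.m≤n⇒m≤1+n a≤i , trans e e′
... | inj₂ e | _            = suc i , ℕₚ.≤-refl , e

T𝔗-upper : ∀ 𝔗 {i j a b} → a ≤ i → b ≤ j → radixAdd 𝔗 a b ≤ T𝔗 𝔗 i j
T𝔗-upper 𝔗 {i} {j} a≤i b≤j = ℕₚ.≤-trans (maxUpTo-upper j (radixAdd 𝔗 _) b≤j)
  (maxUpTo-upper i (λ a → maxUpTo j (radixAdd 𝔗 a)) a≤i)

T𝔗-attained : ∀ 𝔗 i j → ∃₂ λ a b → a ≤ i × b ≤ j × T𝔗 𝔗 i j ≡ radixAdd 𝔗 a b
T𝔗-attained 𝔗 i j with maxUpTo-attained i (λ a → maxUpTo j (radixAdd 𝔗 a))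
... | a , a≤i , e with maxUpTo-attained j (radixAdd 𝔗 a)
...   | b , b≤j , e′ = a , b , a≤i , b≤j , trans e e′

module Digit (m : ℕ) where
  M = suc m

  low : ∀ r q → r < M → (r + M * q) % M ≡ r
  low r q r<M = trans (cong (λ z → (r + z) % M) (ℕₚ.*-comm M q)) (trans ([m+kn]%n≡m%n r q M) (m<n⇒m%n≡m r<M))

  high : ∀ r q → r < M → (r + M * q) / M ≡ q
  high r q r<M = trans (+-distrib-/-∣ʳ r (divides q (ℕₚ.*-comm M q)))
    (cong₂ _+_ (m<n⇒m/n≡0 r<M) (trans (cong (_/ M) (ℕₚ.*-comm M q)) (m*n/n≡m q M)))

  expand : ∀ b → b ≡ b % M + M * (b / M)
  expand b = trans (m≡m%n+[m/n]*n b M) (cong (b % M +_) (ℕₚ.*-comm (b / M) M))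

  bounded : ∀ {r q p} → r < M → q < p → r + M * q < M * p
  bounded {r} {q} {p} r<M q<p = ℕₚ.<-≤-trans (ℕₚ.+-monoˡ-< (M * q) r<M)
    (ℕₚ.≤-trans (ℕₚ.≤-reflexive (sym (ℕₚ.*-suc M q))) (ℕₚ.*-monoʳ-≤ M q<p))

  high-< : ∀ {a} p → a < M * p → a / M < p
  high-< {a} p a< = m<n*o⇒m/o<n (subst (a <_) (ℕₚ.*-comm M p) a<)

  %-+ˡ : ∀ x y → (x % M + y) % M ≡ (x + y) % M
  %-+ˡ x y = trans (%-distribˡ-+ (x % M) y M) (trans (cong (λ z → (z + y % M) % M) (m%n%n≡m%n x M)) (sym (%-distribˡ-+ x y M)))

  %-+ʳ : ∀ x y → (x + y % M) % M ≡ (x + y) % M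
  %-+ʳ x y = trans (cong (_% M) (ℕₚ.+-comm x (y % M))) (trans (%-+ˡ y x) (cong (_% M) (ℕₚ.+-comm y x)))

radixAdd-comm : ∀ 𝔗 a b → radixAdd 𝔗 a b ≡ radixAdd 𝔗 b a
radixAdd-comm []           a b = refl
radixAdd-comm (zero ∷ ms)  a b = refl
radixAdd-comm (suc m ∷ ms) a b = cong₂ (λ r q → r % suc m + suc m * q)
  (ℕₚ.+-comm (a % suc m) (b % suc m)) (radixAdd-comm ms (a / suc m) (b / suc m))

radixAdd-assoc : ∀ 𝔗 a b c → radixAdd 𝔗 (radixAdd 𝔗 a b) c ≡ radixAdd 𝔗 a (radixAdd 𝔗 b c)
radixAdd-assoc []           a b c = refl
radixAdd-assoc (zero ∷ ms)  a b c = refl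
radixAdd-assoc (suc m ∷ ms) a b c = cong₂ (λ r q → r + M * q) digits (begin
  radixAdd ms (radixAdd (M ∷ ms) a b / M) (c / M)   ≡⟨ cong (λ z → radixAdd ms z (c / M)) (high _ _ (m%n<n (a % M + b % M) M)) ⟩
  radixAdd ms (radixAdd ms (a / M) (b / M)) (c / M) ≡⟨ radixAdd-assoc ms (a / M) (b / M) (c / M) ⟩
  radixAdd ms (a / M) (radixAdd ms (b / M) (c / M)) ≡⟨ cong (radixAdd ms (a / M)) (high _ _ (m%n<n (b % M + c % M) M)) ⟨
  radixAdd ms (a / M) (radixAdd (M ∷ ms) b c / M)   ∎)
  where
  open ≡-Reasoning
  open Digit m
  digits : (radixAdd (M ∷ ms) a b % M + c % M) % M ≡ (a % M + radixAdd (M ∷ ms) b c % M) % M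
  digits = begin
    (radixAdd (M ∷ ms) a b % M + c % M) % M   ≡⟨ cong (λ z → (z + c % M) % M) (low _ _ (m%n<n (a % M + b % M) M)) ⟩
    ((a % M + b % M) % M + c % M) % M         ≡⟨ %-+ˡ (a % M + b % M) (c % M) ⟩
    (a % M + b % M + c % M) % M               ≡⟨ cong (_% M) (ℕₚ.+-assoc (a % M) (b % M) (c % M)) ⟩
    (a % M + (b % M + c % M)) % M             ≡⟨ %-+ʳ (a % M) (b % M + c % M) ⟨
    (a % M + (b % M + c % M) % M) % M         ≡⟨ cong (λ z → (a % M + z) % M) (low _ _ (m%n<n (b % M + c % M) M)) ⟨
    (a % M + radixAdd (M ∷ ms) b c % M) % M   ∎

radixAdd-identityˡ : ∀ 𝔗 {b} → b < product 𝔗 → radixAdd 𝔗 0 b ≡ b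
radixAdd-identityˡ []           (s≤s z≤n) = refl
radixAdd-identityˡ (suc m ∷ ms) {b} b<n = begin
  (b % M) % M + M * radixAdd ms (0 / M) (b / M)   ≡⟨ cong₂ (λ r q → r + M * radixAdd ms q (b / M)) (m%n%n≡m%n b M) (0/n≡0 M) ⟩
  b % M + M * radixAdd ms 0 (b / M)               ≡⟨ cong (λ q → b % M + M * q) (radixAdd-identityˡ ms (high-< (product ms) b<n)) ⟩
  b % M + M * (b / M)                             ≡⟨ expand b ⟨
  b                                               ∎
  where
  open ≡-Reasoning
  open Digit m

radixNeg : List ℕ → ℕ → ℕ
radixNeg []           a = 0
radixNeg (zero ∷ ms)  a = 0
radixNeg (suc m ∷ ms) a = (suc m ∸ a % suc m) % suc m + suc m * radixNeg ms (a / suc m)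

radixAdd-inverseʳ : ∀ 𝔗 a → radixAdd 𝔗 a (radixNeg 𝔗 a) ≡ 0
radixAdd-inverseʳ []           a = refl
radixAdd-inverseʳ (zero ∷ ms)  a = refl
radixAdd-inverseʳ (suc m ∷ ms) a = trans (cong₂ (λ r q → r + M * q)
  (begin
    (a % M + radixNeg (M ∷ ms) a % M) % M   ≡⟨ cong (λ z → (a % M + z) % M) (low _ _ (m%n<n (M ∸ a % M) M)) ⟩
    (a % M + (M ∸ a % M) % M) % M           ≡⟨ %-+ʳ (a % M) (M ∸ a % M) ⟩
    (a % M + (M ∸ a % M)) % M               ≡⟨ cong (_% M) (ℕₚ.m+[n∸m]≡n (ℕₚ.<⇒≤ (m%n<n a M))) ⟩
    M % M                                   ≡⟨ n%n≡0 M ⟩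
    0                                       ∎)
  (trans (cong (radixAdd ms (a / M)) (high _ _ (m%n<n (M ∸ a % M) M))) (radixAdd-inverseʳ ms (a / M))))
  (ℕₚ.*-zeroʳ M)
  where
  open ≡-Reasoning
  open Digit m

radixNeg-< : ∀ 𝔗 {a d} → d ∈ prefixProds 𝔗 → a < d → radixNeg 𝔗 a < d
radixNeg-< []           (here refl) _         = s≤s z≤n
radixNeg-< (zero ∷ ms)  (here refl) _         = s≤s z≤n
radixNeg-< (zero ∷ ms)  (there d∈)  a<d with ∈-map⁻ (0 *_) d∈
... | _ , _ , refl = contradiction a<d λ ()
radixNeg-< (suc m ∷ ms) (here refl) (s≤s z≤n) = s≤s (ℕₚ.≤-reflexive (trans (cong₂ (λ r q → r + suc m * q) (n%n≡0 (suc m))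
  (trans (cong (radixNeg ms) (0/n≡0 (suc m))) (ℕₚ.n<1⇒n≡0 (radixNeg-< ms (1∈prefixProds ms) (s≤s z≤n))))) (ℕₚ.*-zeroʳ (suc m))))
radixNeg-< (suc m ∷ ms) {a} (there d∈) a<d with ∈-map⁻ (suc m *_) d∈
... | d , d∈′ , refl = bounded (m%n<n (M ∸ a % M) M) (radixNeg-< ms d∈′ (high-< d a<d))
  where open Digit m

-- With `radixNeg-<`, this makes the numbers below a prefix product a subgroup; it is the mixed
-- radix inequality with h = x = y = d.
radixAdd-< : ∀ 𝔗 {d a b} → d ∈ prefixProds 𝔗 → a < d → b < d → radixAdd 𝔗 a b < d
radixAdd-< 𝔗 {d} {a} {b} d∈ a<d b<d = ℕₚ.+-cancelʳ-< d (radixAdd 𝔗 a b) d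
  (radixAdd-+-< 𝔗 d∈ (divides 1 (sym (ℕₚ.*-identityˡ d))) (divides 1 (sym (ℕₚ.*-identityˡ d))) a<d b<d)

-- Lowering the lowest nonzero digit of b by 1 subtracts a prefix product without borrow.
peel : ∀ 𝔗 b → 0 < b → b < product 𝔗 → ∃₂ λ e c → e ∈ prefixProds 𝔗 × 1 ≤ e × b ≡ e + c × radixAdd 𝔗 e c ≡ b
peel []           b 0<b b<1 = contradiction 0<b (ℕₚ.≤⇒≯ (s≤s⁻¹ b<1))
peel (suc m ∷ ms) b 0<b b<n with b % suc m in eq
... | zero with peel ms (b / suc m) (ℕₚ.n≢0⇒n>0 b/M≢0) (high-< (product ms) b<n)
  where
  open Digit m
  b/M≢0 : b / suc m ≢ 0
  b/M≢0 e = ℕₚ.<-irrefl (sym (trans (expand b) (trans (cong₂ (λ r q → r + M * q) eq e) (ℕₚ.*-zeroʳ M)))) 0<b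
...   | e , c , e∈ , 1≤e , b/M≡ , sum =
  M * e , M * c , there (∈-map⁺ (M *_) e∈) , ℕₚ.*-mono-≤ {1} {M} (s≤s z≤n) 1≤e ,
  trans (b≡) (trans (cong (M *_) b/M≡) (ℕₚ.*-distribˡ-+ M e c)) ,
  (begin
    ((M * e) % M + (M * c) % M) % M + M * radixAdd ms (M * e / M) (M * c / M)
      ≡⟨ cong₂ (λ r q → r % M + M * q) (cong₂ _+_ (low 0 e (s≤s z≤n)) (low 0 c (s≤s z≤n)))
           (cong₂ (radixAdd ms) (high 0 e (s≤s z≤n)) (high 0 c (s≤s z≤n))) ⟩
    M * radixAdd ms e c   ≡⟨ cong (M *_) sum ⟩
    M * (b / M)           ≡⟨ b≡ ⟨
    b                     ∎)
  where
  open ≡-Reasoning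
  open Digit m
  b≡ : b ≡ M * (b / M)
  b≡ = trans (expand b) (cong (_+ M * (b / M)) eq)
peel (suc m ∷ ms) b 0<b b<n | suc r =
  1 , r + M * (b / M) , here refl , s≤s z≤n , b≡ ,
  (begin
    (1 % M + (r + M * (b / M)) % M) % M + M * radixAdd ms (1 / M) ((r + M * (b / M)) / M)
      ≡⟨ cong₂ (λ s q → s % M + M * q) (cong₂ _+_ (m<n⇒m%n≡m 1<M) (low r (b / M) r<M))
           (cong₂ (radixAdd ms) (m<n⇒m/n≡0 1<M) (high r (b / M) r<M)) ⟩
    suc r % M + M * radixAdd ms 0 (b / M)
      ≡⟨ cong₂ (λ s q → s + M * q) (m<n⇒m%n≡m 1+r<M) (radixAdd-identityˡ ms (high-< (product ms) b<n)) ⟩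
    suc r + M * (b / M)   ≡⟨ b≡ ⟨
    b                     ∎)
  where
  open ≡-Reasoning
  open Digit m
  1+r<M : suc r < M
  1+r<M = subst (_< M) eq (m%n<n b M)
  r<M : r < M
  r<M = ℕₚ.<-trans (ℕₚ.n<1+n r) 1+r<M
  1<M : 1 < M
  1<M = ℕₚ.≤-<-trans (s≤s z≤n) 1+r<M
  b≡ : b ≡ suc r + M * (b / M)
  b≡ = trans (expand b) (cong (_+ M * (b / M)) eq)

prefixProd≥1 : ∀ {𝔗 d} → IsTowerType 𝔗 → d ∈ prefixProds 𝔗 → 1 ≤ d
prefixProd≥1 []  (here refl) = s≤s z≤n
prefixProd≥1 (_ ∷ _) (here refl) = s≤s z≤n
prefixProd≥1 {m ∷ _} (m≥2 ∷ tow) (there d∈) with ∈-map⁻ (m *_) d∈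
... | d , d∈′ , refl = ℕₚ.*-mono-≤ (ℕₚ.≤-trans (s≤s z≤n) m≥2) (prefixProd≥1 tow d∈′)

prefixProd≤product : ∀ {𝔗 d} → IsTowerType 𝔗 → d ∈ prefixProds 𝔗 → d ≤ product 𝔗
prefixProd≤product [] (here refl) = ℕₚ.≤-refl
prefixProd≤product tow@(_ ∷ _) (here refl) = product≥1 tow
prefixProd≤product {m ∷ _} (_ ∷ tow) (there d∈) with ∈-map⁻ (m *_) d∈
... | d , d∈′ , refl = ℕₚ.*-monoʳ-≤ m (prefixProd≤product tow d∈′)

-- Applied to the prefix products, this finds the order of the subgroup generated by F_i; the last
-- clause puts the elements indexed by the smaller prefix products into F_i.
least-above : ∀ i ds d → d ∈ ds → i < d → ∃ λ d → d ∈ ds × i < d × (∀ {e} → e ∈ ds → e < d → e ≤ i)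
least-above i ds = <-rec _ λ d rec d∈ i<d → case d∈ i<d (λ {e} → rec {e}) (any? (λ e → (i <? e) ×-dec (e <? d)) ds)
  where
  Least : Set
  Least = ∃ λ d → d ∈ ds × i < d × (∀ {e} → e ∈ ds → e < d → e ≤ i)
  case : ∀ {d} → d ∈ ds → i < d → (∀ {e} → e < d → e ∈ ds → i < e → Least) → Dec (Any (λ e → i < e × e < d) ds) → Least
  case d∈ i<d rec (yes smaller) with find smaller
  ... | e , e∈ , i<e , e<d = rec e<d e∈ i<e
  case d∈ i<d rec (no none) = _ , d∈ , i<d , λ e∈ e<d → ℕₚ.≮⇒≥ λ i<e → none (lose e∈ (i<e , e<d))

-- The standard flag

module Standard {𝔗} (tow : IsTowerType 𝔗) where
  n = product 𝔗

  infixl 7 _⊕_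
  _⊕_ : Fin n → Fin n → Fin n
  a ⊕ b = fromℕ< (radixAdd-<-product 𝔗 (Finₚ.toℕ<n a) (Finₚ.toℕ<n b))

  toℕ-⊕ : ∀ a b → toℕ (a ⊕ b) ≡ radixAdd 𝔗 (toℕ a) (toℕ b)
  toℕ-⊕ a b = Finₚ.toℕ-fromℕ< _

  𝟘 : Fin n
  𝟘 = fromℕ< (product≥1 tow)

  toℕ-𝟘 : toℕ 𝟘 ≡ 0
  toℕ-𝟘 = Finₚ.toℕ-fromℕ< (product≥1 tow)

  ⊖_ : Fin n → Fin n
  ⊖ a = fromℕ< (radixNeg-< 𝔗 (product∈prefixProds 𝔗) (Finₚ.toℕ<n a))

  ⊕-comm : ∀ a b → a ⊕ b ≡ b ⊕ a
  ⊕-comm a b = Finₚ.toℕ-injective (trans (toℕ-⊕ a b) (trans (radixAdd-comm 𝔗 (toℕ a) (toℕ b)) (sym (toℕ-⊕ b a))))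

  ⊕-assoc : ∀ a b c → (a ⊕ b) ⊕ c ≡ a ⊕ (b ⊕ c)
  ⊕-assoc a b c = Finₚ.toℕ-injective (begin
    toℕ ((a ⊕ b) ⊕ c)                                   ≡⟨ toℕ-⊕ (a ⊕ b) c ⟩
    radixAdd 𝔗 (toℕ (a ⊕ b)) (toℕ c)                    ≡⟨ cong (λ z → radixAdd 𝔗 z (toℕ c)) (toℕ-⊕ a b) ⟩
    radixAdd 𝔗 (radixAdd 𝔗 (toℕ a) (toℕ b)) (toℕ c)     ≡⟨ radixAdd-assoc 𝔗 (toℕ a) (toℕ b) (toℕ c) ⟩
    radixAdd 𝔗 (toℕ a) (radixAdd 𝔗 (toℕ b) (toℕ c))     ≡⟨ cong (radixAdd 𝔗 (toℕ a)) (toℕ-⊕ b c) ⟨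
    radixAdd 𝔗 (toℕ a) (toℕ (b ⊕ c))                    ≡⟨ toℕ-⊕ a (b ⊕ c) ⟨
    toℕ (a ⊕ (b ⊕ c))                                   ∎)
    where open ≡-Reasoning

  ⊕-identityˡ : ∀ a → 𝟘 ⊕ a ≡ a
  ⊕-identityˡ a = Finₚ.toℕ-injective (trans (toℕ-⊕ 𝟘 a)
    (trans (cong (λ z → radixAdd 𝔗 z (toℕ a)) toℕ-𝟘) (radixAdd-identityˡ 𝔗 (Finₚ.toℕ<n a))))

  ⊕-inverseʳ : ∀ a → a ⊕ (⊖ a) ≡ 𝟘
  ⊕-inverseʳ a = Finₚ.toℕ-injective (trans (toℕ-⊕ a (⊖ a)) (trans (cong (radixAdd 𝔗 (toℕ a)) (Finₚ.toℕ-fromℕ< _))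
    (trans (radixAdd-inverseʳ 𝔗 (toℕ a)) (sym toℕ-𝟘))))

  group : AbelianGroup 0ℓ 0ℓ
  group = record
    { Carrier = Fin n ; _≈_ = _≡_ ; _∙_ = _⊕_ ; ε = 𝟘 ; _⁻¹ = ⊖_
    ; isAbelianGroup = record
      { isGroup = record
        { isMonoid = record
          { isSemigroup = record
            { isMagma = record { isEquivalence = isEquivalence ; ∙-cong = cong₂ _⊕_ }
            ; assoc = ⊕-assoc }
          ; identity = ⊕-identityˡ , λ a → trans (⊕-comm a 𝟘) (⊕-identityˡ a) }
        ; inverse = (λ a → trans (⊕-comm (⊖ a) a) (⊕-inverseʳ a)) , ⊕-inverseʳ
        ; ⁻¹-cong = cong ⊖_ }
      ; comm = ⊕-comm } }

  flag : GroupFlag group n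
  flag = record
    { v = id
    ; v-one = λ i i≡0 → Finₚ.toℕ-injective (trans i≡0 (sym toℕ-𝟘))
    ; v-inj = λ _ _ → id
    ; v-surj = λ g → g , refl }

  generated-< : ∀ {i d} → d ∈ prefixProds 𝔗 → toℕ i < d → ∀ {x} → GGen group flag i x → toℕ x < d
  generated-< d∈ i<d (gen (b , b≤i , refl)) = ℕₚ.≤-<-trans b≤i i<d
  generated-< d∈ i<d one                    = subst (_< _) (sym toℕ-𝟘) (prefixProd≥1 tow d∈)
  generated-< d∈ i<d (mul {x} {y} gx gy)    = subst (_< _) (sym (toℕ-⊕ x y)) (radixAdd-< 𝔗 d∈ (generated-< d∈ i<d gx) (generated-< d∈ i<d gy))
  generated-< d∈ i<d (inv gx)               = subst (_< _) (sym (Finₚ.toℕ-fromℕ< _)) (radixNeg-< 𝔗 d∈ (generated-< d∈ i<d gx))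
  generated-< d∈ i<d (resp refl gx)         = generated-< d∈ i<d gx

  -- An index above i is peeled into a prefix product e and a smaller index. As e < d, the
  -- hypothesis `gap` puts e in F_i, and the remainder is generated by induction.
  generates : ∀ i {d} → d ≤ n → (∀ {e} → e ∈ prefixProds 𝔗 → e < d → e ≤ toℕ i) → ∀ x → toℕ x < d → GGen group flag i x
  generates i {d} d≤n gap x x<d = go (toℕ x) x refl x<d
    where
    go : ∀ b x → toℕ x ≡ b → b < d → GGen group flag i x
    go = <-rec _ λ b rec x x≡b b<d → case b (λ {c} → rec {c}) x x≡b b<d (b ≤? toℕ i)
      where
      case : ∀ b → (∀ {c} → c < b → ∀ x → toℕ x ≡ c → c < d → GGen group flag i x) →
             ∀ x → toℕ x ≡ b → b < d → Dec (b ≤ toℕ i) → GGen group flag i x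
      case b rec x refl b<d (yes b≤i) = gen (x , b≤i , refl)
      case b rec x refl b<d (no b≰i) with peel 𝔗 b (ℕₚ.≤-<-trans z≤n (ℕₚ.≰⇒> b≰i)) (Finₚ.toℕ<n x)
      ... | e , c , e∈ , 1≤e , b≡e+c , sum = resp (Finₚ.toℕ-injective eq)
              (mul (gen (e′ , subst (_≤ toℕ i) (sym e′≡) (gap e∈ e<d) , refl)) (rec c<b c′ c′≡ (ℕₚ.<-trans c<b b<d)))
        where
        c<b : c < b
        c<b = subst (c <_) (sym b≡e+c) (ℕₚ.m<n+m c 1≤e)
        e<d : e < d
        e<d = ℕₚ.≤-<-trans (subst (e ≤_) (sym b≡e+c) (ℕₚ.m≤m+n e c)) b<d
        e′ c′ : Fin n
        e′ = fromℕ< (ℕₚ.<-≤-trans e<d d≤n)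
        c′ = fromℕ< (ℕₚ.<-trans c<b (Finₚ.toℕ<n x))
        e′≡ : toℕ e′ ≡ e
        e′≡ = Finₚ.toℕ-fromℕ< _
        c′≡ : toℕ c′ ≡ c
        c′≡ = Finₚ.toℕ-fromℕ< _
        eq : toℕ (e′ ⊕ c′) ≡ toℕ x
        eq = trans (toℕ-⊕ e′ c′) (trans (cong₂ (radixAdd 𝔗) e′≡ c′≡) sum)

  generated-size : ∀ i {d} → d ∈ prefixProds 𝔗 → toℕ i < d → (∀ {e} → e ∈ prefixProds 𝔗 → e < d → e ≤ toℕ i) →
                   HasSize group (GGen group flag i) d
  generated-size i {d} d∈ i<d gap =
      (λ s → inject≤ s d≤n)
    , (λ s → generates i d≤n gap _ (subst (_< d) (sym (Finₚ.toℕ-inject≤ s d≤n)) (Finₚ.toℕ<n s)))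
    , (λ s t → Finₚ.inject≤-injective d≤n d≤n s t)
    , λ x gx → let x<d = generated-< d∈ i<d gx in
        fromℕ< x<d , Finₚ.toℕ-injective (sym (trans (Finₚ.toℕ-inject≤ _ d≤n) (Finₚ.toℕ-fromℕ< x<d)))
    where d≤n = prefixProd≤product tow d∈

  hasTowerType : GHasTowerType group flag 𝔗
  hasTowerType = sizes , occurs
    where
    sizes : ∀ i → ∃ λ d → HasSize group (GGen group flag i) d × d ∈ prefixProds 𝔗
    sizes i with least-above (toℕ i) (prefixProds 𝔗) n (product∈prefixProds 𝔗) (Finₚ.toℕ<n i)
    ... | d , d∈ , i<d , gap = d , generated-size i d∈ i<d gap , d∈
    occurs : ∀ d → d ∈ prefixProds 𝔗 → ∃ λ i → HasSize group (GGen group flag i) d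
    occurs zero    d∈ = contradiction (prefixProd≥1 tow d∈) λ ()
    -- A prefix product D is the order of the subgroup generated by F_i for i = D - 1, where F_i is
    -- already the subgroup of the indices below D.
    occurs (suc d) d∈ = fromℕ< d<n , generated-size (fromℕ< d<n) d∈ (s≤s (ℕₚ.≤-reflexive (Finₚ.toℕ-fromℕ< d<n)))
        λ _ e<1+d → ℕₚ.≤-trans (s≤s⁻¹ e<1+d) (ℕₚ.≤-reflexive (sym (Finₚ.toℕ-fromℕ< d<n)))
      where d<n = prefixProd≤product tow d∈

  T𝔗<n : ∀ (i j : Fin n) → T𝔗 𝔗 (toℕ i) (toℕ j) < n
  T𝔗<n i j with T𝔗-attained 𝔗 (toℕ i) (toℕ j)
  ... | a , b , a≤i , b≤j , e = subst (_< n) (sym e)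
    (radixAdd-<-product 𝔗 (ℕₚ.≤-<-trans a≤i (Finₚ.toℕ<n i)) (ℕₚ.≤-<-trans b≤j (Finₚ.toℕ<n j)))

  T : Fin n → Fin n → Fin n
  T i j = fromℕ< (T𝔗<n i j)

  isFlagType : GIsFlagType group flag T
  isFlagType i j =
      (λ { _ _ (a , a≤i , refl) (b , b≤j , refl) → a ⊕ b ,
             subst₂ _≤_ (sym (toℕ-⊕ a b)) (sym (Finₚ.toℕ-fromℕ< (T𝔗<n i j))) (T𝔗-upper 𝔗 a≤i b≤j) , refl })
    , minimal
    where
    minimal : ∀ k → GProdSub group flag i j k → toℕ (T i j) ≤ toℕ k
    minimal k ij⊆k with T𝔗-attained 𝔗 (toℕ i) (toℕ j)
    ... | a , b , a≤i , b≤j , e with ij⊆k a′ b′ (a′ , subst (_≤ toℕ i) (sym a′≡) a≤i , refl) (b′ , subst (_≤ toℕ j) (sym b′≡) b≤j , refl)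
      where
      a′ b′ : Fin n
      a′ = fromℕ< (ℕₚ.≤-<-trans a≤i (Finₚ.toℕ<n i))
      b′ = fromℕ< (ℕₚ.≤-<-trans b≤j (Finₚ.toℕ<n j))
      a′≡ : toℕ a′ ≡ a
      a′≡ = Finₚ.toℕ-fromℕ< _
      b′≡ : toℕ b′ ≡ b
      b′≡ = Finₚ.toℕ-fromℕ< _
    ...   | c , c≤k , refl = ℕₚ.≤-trans (ℕₚ.≤-reflexive (trans (Finₚ.toℕ-fromℕ< (T𝔗<n i j)) (trans e
              (sym (trans (toℕ-⊕ _ _) (cong₂ (radixAdd 𝔗) (Finₚ.toℕ-fromℕ< _) (Finₚ.toℕ-fromℕ< _))))))) c≤k

theorem1p14 : ∀ {a ℓ k kℓ l lℓ} (𝔗 : List ℕ) → IsTowerType 𝔗 → Condition 𝔗 →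
    (Σ (AbelianGroup 0ℓ 0ℓ) λ G → Σ (GroupFlag G (product 𝔗)) λ F →
    GHasTowerType G F 𝔗 × Σ (Fin (product 𝔗) → Fin (product 𝔗) → Fin (product 𝔗)) λ T →
    GIsFlagType G F T × (∀ i j → toℕ (T i j) ≡ T𝔗 𝔗 (toℕ i) (toℕ j)))
    × (∀ (G : AbelianGroup a ℓ) (F : GroupFlag G (product 𝔗)) → GHasTowerType G F 𝔗 →
    ∀ T → GIsFlagType G F T → ∀ i j → T𝔗 𝔗 (toℕ i) (toℕ j) ≤ toℕ (T i j))
    × (∀ (K : Field k kℓ) (L : Field l lℓ) (ι : Field.Carrier K → Field.Carrier L) →
    IsFieldEmbedding K L ι → (F : FieldFlag K L ι (product 𝔗)) → FHasTowerType K L ι F 𝔗 →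
    ∀ T → FIsFlagType K L ι F T → ∀ i j → T𝔗 𝔗 (toℕ i) (toℕ j) ≤ toℕ (T i j))
theorem1p14 𝔗 tow cond =
    (Standard.group tow , Standard.flag tow , Standard.hasTowerType tow , Standard.T tow , Standard.isFlagType tow ,
     λ i j → Finₚ.toℕ-fromℕ< (Standard.T𝔗<n tow i j))
  , (λ G F (sizes , _) T isT i j →
      let (gᵢ , sᵢ , gᵢ∈) = sizes i
          (gⱼ , sⱼ , gⱼ∈) = sizes j
          open GroupGeometry G
      in decidable-stable (_ ≤? _) (group-constraints F (proj₁ (isT i j)) sᵢ sⱼ >>= λ C → return
           (T𝔗-minimal kind C gᵢ∈ gⱼ∈ (Finₚ.toℕ<n i) (Finₚ.toℕ<n j))))
  , (λ K L ι ι-embedding F (dims , _) T isT i j →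
      let (gᵢ , dᵢ , gᵢ∈) = dims i
          (gⱼ , dⱼ , gⱼ∈) = dims j
          open FieldGeometry K L ι ι-embedding
      in decidable-stable (_ ≤? _) (field-constraints F (proj₁ (isT i j)) dᵢ dⱼ >>= λ C → return
           (T𝔗-minimal kind C gᵢ∈ gⱼ∈ (Finₚ.toℕ<n i) (Finₚ.toℕ<n j))))
  where
  kind = condition⇒Kind tow cond
  T𝔗-minimal : ∀ {i j k gᵢ gⱼ} → Kind 𝔗 → Constraints (product 𝔗) i j k gᵢ gⱼ → gᵢ ∈ prefixProds 𝔗 → gⱼ ∈ prefixProds 𝔗 →
               i < product 𝔗 → j < product 𝔗 → T𝔗 𝔗 i j ≤ k
  T𝔗-minimal {i} {j} kind C gᵢ∈ gⱼ∈ i<n j<n = T𝔗-least 𝔗 i j λ a≤i b≤j →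
    radixAdd-≤ a≤i b≤j kind C gᵢ∈ gⱼ∈ i<n j<n
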